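{- Let $p$ be a prime, let $f(x)\in\mathbb{Z}_p[x]$, let $\alpha,n\in\mathbb{N}=\{0,1,2,\dots\}$ and $r\in\mathbb{Z}$. Then $$\operatorname{ord}_p\Bigg(\sum_{k\equiv r\ (\mathrm{mod}\ p^{\alpha})}\binom nk(-1)^kf\Big(\frac{k-r}{p^{\alpha}}\Big)\Bigg)\ \geqslant\ \operatorname{ord}_p\Big(\Big\lfloor\frac n{p^{\alpha-1}}\Big\rfloor!\Big)-\deg f+\tau_p\big(\{r\}_{p^{\alpha-1}},\{n-r\}_{p^{\alpha-1}}\big).$$ Equivalently, $p^{\deg f}\sum_{k\equiv r\,(\mathrm{mod}\ p^{\alpha})}\binom nk(-1)^kf\big(\frac{k-r}{p^{\alpha}}\big)\equiv 0 \pmod{p^{\sum_{i=\alpha}^{\infty}\lfloor n/p^i\rfloor+\tau_p(\{r\}_{p^{\alpha-1}},\{n-r\}_{p^{\alpha-1}})}}$.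
   Context: The sum runs over all integers $k$ with $k\equiv r \pmod{p^\alpha}$; $\binom nk=0$ unless $0\le k\le n$, so it is finite. $\mathbb{Z}_p$ is the ring of $p$-adic integers; for $\omega\in\mathbb{Q}_p\setminus\{0\}$, $\operatorname{ord}_p(\omega)=\max\{a\in\mathbb{Z}:\omega/p^a\in\mathbb{Z}_p\}$ and $\operatorname{ord}_p(0)=+\infty$. The degree of the zero polynomial is $-\infty$. For an integer $a$ and a positive real $m$, $\{a\}_m$ denotes the unique number in $[0,m)$ with $a-\{a\}_m\in m\mathbb{Z}$ (so for $m=p^{ -1}$, $\{a\}_m=0$). For $a,b\in\mathbb{N}$, $\tau_p(a,b)$ is the number of carries when adding $a$ and $b$ in base $p$ (equivalently $\operatorname{ord}_p\binom{a+b}{a}$). When $\alpha=0$, $\lfloor n/p^{ -1}\rfloor=pn$. -}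

module Defs where

open import Algebra.Bundles using (CommutativeRing)
open import Algebra.Structures using (IsCommutativeRing)
open import Data.Bool.Base using (if_then_else_)
open import Data.Fin.Base using (toℕ)
open import Data.Integer.Base as ℤ using (ℤ; +_; -[1+_])
open import Data.Integer.Divisibility.Signed as ℤ∣ using (_∣?_)
import Data.Integer.Properties as ℤ
open import Data.Integer.Tactic.RingSolver using (solve-∀)
open import Data.List.Base using (List; []; _∷_; applyUpTo)
open import Data.Nat.Base as ℕ using (ℕ; zero; suc; NonZero)
open import Data.Nat.Combinatorics using (_C_)
open import Data.Nat.ListAction using (sum)
import Data.Nat.Properties as ℕ
open import Data.Product.Base using (_×_; _,_; ∃-syntax)
open import Relation.Binary.Construct.Add.Supremum.NonStrict ℤ._≤_ using (_≤⁺_) public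
open import Relation.Binary.PropositionalEquality.Core using (_≡_; refl; cong; sym; subst)
open import Relation.Nullary.Construct.Add.Infimum using (_₋; ⊥₋)
open import Relation.Nullary.Construct.Add.Supremum using (_⁺; ⊤⁺; [_])
open import Relation.Nullary.Decidable.Core using (does)
open import Relation.Nullary.Negation.Core using (¬_)

-- v - d + t in ℤ ∪ {+∞}, where d may be -∞; the forms +∞ - d and v - (-∞) are +∞.
_⊖_⊕_ : ℤ ⁺ → ℕ ₋ → ℕ → ℤ ⁺
[ v ] ⊖ [ d ] ⊕ t = [ (v ℤ.- + d) ℤ.+ + t ]
[ v ] ⊖ ⊥₋    ⊕ t = ⊤⁺
⊤⁺    ⊖ d     ⊕ t = ⊤⁺

module Padic (p : ℕ) .{{_ : NonZero p}} where

  ⌊_/p^_⌋ : ℕ → ℕ → ℕ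
  ⌊ a /p^ i ⌋ = ℕ._/_ a (p ℕ.^ i) {{ℕ.m^n≢0 p i}}

  ⌊_/p^_⌋ℤ : ℤ → ℕ → ℤ
  ⌊ a /p^ i ⌋ℤ = ℤ._/ℕ_ a (p ℕ.^ i) {{ℕ.m^n≢0 p i}}

  _%p^_ : ℤ → ℕ → ℕ
  a %p^ i = ℤ._%ℕ_ a (p ℕ.^ i) {{ℕ.m^n≢0 p i}}

  pow : ℕ → ℤ
  pow i = + (p ℕ.^ i)

  -- ℤₚ as the inverse limit of the rings ℤ/pⁱ: the i-th component is an
  -- integer representing a residue class modulo pⁱ.
  record ℤₚ : Set where
    field
      approx   : ℕ → ℤ
      coherent : ∀ i → pow i ℤ∣.∣ approx (suc i) ℤ.- approx i
  open ℤₚ public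

  infix 4 _≈_
  record _≈_ (x y : ℤₚ) : Set where
    constructor mk≈
    field
      congruent : ∀ i → pow i ℤ∣.∣ approx x i ℤ.- approx y i
  open _≈_ public

  fromℤ : ℤ → ℤₚ
  fromℤ z .approx _   = z
  fromℤ z .coherent i = subst (pow i ℤ∣.∣_) (sym (ℤ.+-inverseʳ z)) (ℤ∣.divides ℤ.0ℤ refl)

  private
    +-split : ∀ a b c d → (a ℤ.- c) ℤ.+ (b ℤ.- d) ≡ (a ℤ.+ b) ℤ.- (c ℤ.+ d)
    +-split = solve-∀

    *-split : ∀ a b c d → a ℤ.* (b ℤ.- d) ℤ.+ (a ℤ.- c) ℤ.* d ≡ a ℤ.* b ℤ.- c ℤ.* d
    *-split = solve-∀

    neg-split : ∀ a b → ℤ.- (a ℤ.- b) ≡ ℤ.- a ℤ.- (ℤ.- b)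
    neg-split = solve-∀

    sym-split : ∀ a b → ℤ.- (a ℤ.- b) ≡ b ℤ.- a
    sym-split = solve-∀

    trans-split : ∀ a b c → (a ℤ.- b) ℤ.+ (b ℤ.- c) ≡ a ℤ.- c
    trans-split = solve-∀

    ∣-+ : ∀ {m a b c d} → m ℤ∣.∣ a ℤ.- c → m ℤ∣.∣ b ℤ.- d → m ℤ∣.∣ (a ℤ.+ b) ℤ.- (c ℤ.+ d)
    ∣-+ {m} {a} {b} {c} {d} u v = subst (m ℤ∣.∣_) (+-split a b c d) (ℤ∣.∣m∣n⇒∣m+n u v)

    ∣-* : ∀ {m a b c d} → m ℤ∣.∣ a ℤ.- c → m ℤ∣.∣ b ℤ.- d → m ℤ∣.∣ a ℤ.* b ℤ.- c ℤ.* d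
    ∣-* {m} {a} {b} {c} {d} u v =
      subst (m ℤ∣.∣_) (*-split a b c d) (ℤ∣.∣m∣n⇒∣m+n (ℤ∣.∣n⇒∣m*n a v) (ℤ∣.∣m⇒∣m*n d u))

    ∣-neg : ∀ {m a b} → m ℤ∣.∣ a ℤ.- b → m ℤ∣.∣ ℤ.- a ℤ.- (ℤ.- b)
    ∣-neg {m} {a} {b} u = subst (m ℤ∣.∣_) (neg-split a b) (ℤ∣.∣m⇒∣-m u)

  infixl 6 _+ₚ_
  infixl 7 _*ₚ_

  _+ₚ_ : ℤₚ → ℤₚ → ℤₚ
  (x +ₚ y) .approx i   = approx x i ℤ.+ approx y i
  (x +ₚ y) .coherent i = ∣-+ {a = approx x (suc i)} (coherent x i) (coherent y i)

  _*ₚ_ : ℤₚ → ℤₚ → ℤₚ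
  (x *ₚ y) .approx i   = approx x i ℤ.* approx y i
  (x *ₚ y) .coherent i = ∣-* {a = approx x (suc i)} (coherent x i) (coherent y i)

  -ₚ_ : ℤₚ → ℤₚ
  (-ₚ x) .approx i   = ℤ.- approx x i
  (-ₚ x) .coherent i = ∣-neg {a = approx x (suc i)} (coherent x i)

  pointwise : ∀ {x y} → (∀ i → approx x i ≡ approx y i) → x ≈ y
  pointwise {x} {y} eq .congruent i =
    subst (λ z → pow i ℤ∣.∣ approx x i ℤ.- z) (eq i) (fromℤ (approx x i) .coherent i)

  ℤₚ-isCommutativeRing : IsCommutativeRing _≈_ _+ₚ_ _*ₚ_ -ₚ_ (fromℤ ℤ.0ℤ) (fromℤ ℤ.1ℤ)
  ℤₚ-isCommutativeRing = record
    { isRing = record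
      { +-isAbelianGroup = record
        { isGroup = record
          { isMonoid = record
            { isSemigroup = record
              { isMagma = record
                { isEquivalence = record
                  { refl  = pointwise (λ _ → refl)
                  ; sym   = λ {x} {y} e → mk≈ λ i →
                      subst (pow i ℤ∣.∣_) (sym-split (approx x i) (approx y i))
                        (ℤ∣.∣m⇒∣-m (congruent e i))
                  ; trans = λ {x} {y} {z} e e′ → mk≈ λ i →
                      subst (pow i ℤ∣.∣_) (trans-split (approx x i) (approx y i) (approx z i))
                        (ℤ∣.∣m∣n⇒∣m+n (congruent e i) (congruent e′ i))
                  }
                ; ∙-cong = λ {x} e e′ → mk≈ λ i →
                    ∣-+ {a = approx x i} (congruent e i) (congruent e′ i)
                }
              ; assoc = λ x y z → pointwise λ i →
                  ℤ.+-assoc (approx x i) (approx y i) (approx z i)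
              }
            ; identity = (λ x → pointwise λ i → ℤ.+-identityˡ (approx x i))
                       , (λ x → pointwise λ i → ℤ.+-identityʳ (approx x i))
            }
          ; inverse = (λ x → pointwise λ i → ℤ.+-inverseˡ (approx x i))
                    , (λ x → pointwise λ i → ℤ.+-inverseʳ (approx x i))
          ; ⁻¹-cong = λ {x} e → mk≈ λ i → ∣-neg {a = approx x i} (congruent e i)
          }
        ; comm = λ x y → pointwise λ i → ℤ.+-comm (approx x i) (approx y i)
        }
      ; *-cong = λ {x} e e′ → mk≈ λ i →
          ∣-* {a = approx x i} (congruent e i) (congruent e′ i)
      ; *-assoc = λ x y z → pointwise λ i →
          ℤ.*-assoc (approx x i) (approx y i) (approx z i)
      ; *-identity = (λ x → pointwise λ i → ℤ.*-identityˡ (approx x i))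
                   , (λ x → pointwise λ i → ℤ.*-identityʳ (approx x i))
      ; distrib = (λ x y z → pointwise λ i →
                     ℤ.*-distribˡ-+ (approx x i) (approx y i) (approx z i))
                , (λ x y z → pointwise λ i →
                     ℤ.*-distribʳ-+ (approx x i) (approx y i) (approx z i))
      }
    ; *-comm = λ x y → pointwise λ i → ℤ.*-comm (approx x i) (approx y i)
    }

  ℤₚ-commutativeRing : CommutativeRing _ _
  ℤₚ-commutativeRing = record { isCommutativeRing = ℤₚ-isCommutativeRing }

  open CommutativeRing ℤₚ-commutativeRing public
    using (0#; *-rawMagma; +-rawMonoid)
    renaming (_+_ to infixl 6 _⊞_; _*_ to infixl 7 _⊠_)
  open import Algebra.Definitions.RawMagma *-rawMagma public using (_∣_)
  open import Algebra.Definitions.RawMonoid +-rawMonoid public renaming (sum to ∑) using ()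

  pᵉ : ℕ → ℤₚ
  pᵉ i = fromℤ (pow i)

  -- ω / pᵃ ∈ ℤₚ, for ω ∈ ℤₚ and an arbitrary integer a.
  _÷p^_∈ℤₚ : ℤₚ → ℤ → Set
  ω ÷p^ (+ a)    ∈ℤₚ = pᵉ a ∣ ω
  ω ÷p^ -[1+ a ] ∈ℤₚ = ∃[ z ] z ≈ pᵉ (suc a) ⊠ ω

  -- IsOrd ω v means ordₚ(ω) = v. It is a relation because whether ω is zero,
  -- and hence the value of ordₚ(ω), is not decidable.
  IsOrd : ℤₚ → ℤ ⁺ → Set
  IsOrd ω ⊤⁺    = ω ≈ 0#
  IsOrd ω [ a ] = ¬ (ω ≈ 0#) × ω ÷p^ a ∈ℤₚ × (∀ b → ω ÷p^ b ∈ℤₚ → b ℤ.≤ a)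

  -- Coefficients, constant term first; trailing zeros are allowed.
  Poly : Set
  Poly = List ℤₚ

  coeff : Poly → ℕ → ℤₚ
  coeff []      _       = 0#
  coeff (a ∷ f) zero    = a
  coeff (a ∷ f) (suc i) = coeff f i

  eval : Poly → ℤₚ → ℤₚ
  eval []      x = 0#
  eval (a ∷ f) x = a ⊞ x ⊠ eval f x

  HasDegree : Poly → ℕ ₋ → Set
  HasDegree f ⊥₋    = ∀ i → coeff f i ≈ 0#
  HasDegree f [ d ] = ¬ (coeff f d ≈ 0#) × (∀ i → d ℕ.< i → coeff f i ≈ 0#)

  -- p ^ deg f, with p ^ (-∞) = 0.
  p^deg : ℕ ₋ → ℤₚ
  p^deg ⊥₋    = 0#
  p^deg [ d ] = pᵉ d

  -- C(n,k) (-1)ᵏ f((k - r)/p^α) if k ≡ r (mod p^α), where the floor is exact,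
  -- and 0 otherwise.
  binomialTerm : Poly → (α n : ℕ) → ℤ → ℕ → ℤₚ
  binomialTerm f α n r k = if does (pow α ∣? (+ k ℤ.- r))
    then fromℤ (+ (n C k) ℤ.* ℤ.-1ℤ ℤ.^ k) ⊠ eval f (fromℤ ⌊ + k ℤ.- r /p^ α ⌋ℤ)
    else 0#

  -- Only the k with 0 ≤ k ≤ n contribute to the sum over all integers k.
  binomialSum : Poly → (α n : ℕ) → ℤ → ℤₚ
  binomialSum f α n r = ∑ {suc n} λ k → binomialTerm f α n r (toℕ k)

  -- floorQuot n α = ⌊ n / p^(α-1) ⌋
  floorQuot : ℕ → ℕ → ℕ
  floorQuot n zero    = p ℕ.* n
  floorQuot n (suc β) = ⌊ n /p^ β ⌋

  -- residue a α = {a}_m for m = p^(α-1), which is 0 when α = 0, as m = 1/p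
  residue : ℤ → ℕ → ℕ
  residue a zero    = 0
  residue a (suc β) = a %p^ β

  digit : ℕ → ℕ → ℕ
  digit a i = ⌊ a /p^ i ⌋ ℕ.% p

  -- The carry into position i in the schoolbook addition of a and b in base p.
  carry : ℕ → ℕ → ℕ → ℕ
  carry a b zero    = 0
  carry a b (suc i) = (digit a i ℕ.+ digit b i ℕ.+ carry a b i) ℕ./ p

  -- The number of carries. For p ≥ 2 every carry is 0 or 1, and a carry into
  -- position i + 1 forces i + 1 < p^(i+1) ≤ a + b, so the range is exhaustive.
  τ : ℕ → ℕ → ℕ
  τ a b = sum (applyUpTo (λ i → carry a b (suc i)) (a ℕ.+ b))

  -- ∑_{i ≥ α} ⌊n/pⁱ⌋. For p ≥ 2 the terms with i ≥ α + n vanish, as n < pⁿ.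
  ∑⌊_/p^i⌋,i≥_ : ℕ → ℕ → ℕ
  ∑⌊ n /p^i⌋,i≥ α = sum (applyUpTo (λ j → ⌊ n /p^ (α ℕ.+ j) ⌋) n)

module Submission where

-- The sum is the value of (1 - X)ⁿ ∈ ℤ[X] under the functional sending Xᵏ to f((k - r)/p^α) if
-- k ≡ r (mod p^α) and to 0 otherwise. Put Q = p^(α-1) and v = X^Q - 1. Multiplying by X^(pQ) - 1
-- replaces f by a difference of f, so when values for weights of degree l are scaled by pˡ, its
-- j-th power contributes pʲ j!. Now vᵖ = (X^(pQ) - 1) - p v u with u ∈ ℤ[X^Q], and induction on
-- m ↦ ⌊m/p⌋ shows that vᵐ contributes m!, up to p-adic units.
-- Next (X - 1)^Q = v + w, where the coefficient of Xʲ in w is divisible by p and, by Kummer, by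
-- the power of p that the carries for exponents congruent to j require. So wᵐ contributes
-- pᵐ⁻¹ besides the carries, which suffices as ord (m!) < m, and (v + w)ᵐ contributes m! by the
-- binomial theorem. For m = ⌊n/Q⌋ the remaining factor (X - 1)^(n mod Q) provides the carries of
-- {r} + {n - r}, again by Kummer. For α = 0 simply (X - 1)ⁿ is a power of X^(pQ) - 1.

open import Defs
open import Algebra.Bundles using (CommutativeRing)
open import Algebra.Structures using (IsCommutativeRing)
open import Data.Bool.Base using (true; false; if_then_else_)
open import Data.Fin.Base using (Fin; toℕ; fromℕ; inject₁) renaming (zero to fzero; suc to fsuc)
open import Data.Fin.Properties using (toℕ<n; toℕ-fromℕ; toℕ-inject₁)
open import Data.Integer.Base as ℤ using (ℤ; +_; -[1+_]; _-_; 0ℤ; 1ℤ; -1ℤ)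
open import Data.Integer.Divisibility.Signed as ℤ∣ using (_∣?_)
import Data.Integer.DivMod as ℤ
import Data.Integer.Properties as ℤ
import Data.Integer.Tactic.RingSolver as ℤ-Solver
open import Data.List.Base using (List; []; _∷_; applyUpTo; map)
open import Data.Nat.Base
open import Data.Nat.Combinatorics using (_C_; nCk≡n!/k![n-k]!; k![n∸k]!∣n!; nCn≡1)
open import Data.Nat.DivMod
open import Data.Nat.Divisibility hiding (_∣?_) renaming (_∣_ to _∣ℕ_)
open import Data.Nat.Induction using (<-rec)
open import Data.Nat.ListAction using (sum)
open import Data.Nat.Primality
open import Data.Nat.Properties
open import Data.Nat.Tactic.RingSolver using (solve-∀)
open import Data.Product.Base using (_×_; _,_; ∃-syntax; proj₁; proj₂)
open import Data.Sum.Base using (_⊎_; inj₁; inj₂; [_,_]′)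
open import Function.Base using (_∘_)
open import Level using (0ℓ)
open import Relation.Binary.Construct.Add.Supremum.NonStrict ℤ._≤_ using ([_]; _≤⊤⁺)
open import Relation.Binary.PropositionalEquality hiding (J)
open import Relation.Nullary hiding (Stable)
open import Relation.Nullary.Construct.Add.Infimum using (_₋; ⊥₋)
open import Relation.Nullary.Construct.Add.Supremum using (_⁺; ⊤⁺; [_])

-- The required exponent depends on `r`, and multiplication by `X` moves `r`. So what is propagated
-- is a function `T` of `r`, for all `r` and all degrees `l` at once: the predicate `J`. With β = α
-- - 1, the function that works is `t₀ β r` = β - min(β, ord r). It vanishes at multiples of Q, so
-- X^Q, and with it v, acts without loss. It is ultrametric, so a shift by j costs at most `t₀ β j`,
-- which is exactly what the coefficient C(Q, j) pays for. One factor w may spend all its powers of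
-- p on that cost. But once max(1, t₀) powers are present, the shift asks only for a maximum of two
-- positive exponents where the coefficient makes them add up, and a sum of two positive integers
-- exceeds their maximum. Hence every factor w except the first gains a p. All of this is about
-- integers. The p-adic polynomial enters through one component, modulo p^K with K the exponent to
-- be reached before deg f is subtracted.

Σ< : (ℕ → ℕ) → ℕ → ℕ
Σ< f n = sum (applyUpTo f n)

Σ<-cong : ∀ {f g} → (∀ i → f i ≡ g i) → ∀ n → Σ< f n ≡ Σ< g n
Σ<-cong f≡g zero    = refl
Σ<-cong f≡g (suc n) = cong₂ _+_ (f≡g 0) (Σ<-cong (f≡g ∘ suc) n)

Σ<-mono : ∀ {f g} n → (∀ i → i < n → f i ≤ g i) → Σ< f n ≤ Σ< g n
Σ<-mono zero    f≤g = z≤n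
Σ<-mono (suc n) f≤g = +-mono-≤ (f≤g 0 z<s) (Σ<-mono n λ i i<n → f≤g (suc i) (s<s i<n))

Σ<-+ : ∀ f g n → Σ< (λ i → f i + g i) n ≡ Σ< f n + Σ< g n
Σ<-+ f g zero    = refl
Σ<-+ f g (suc n) rewrite Σ<-+ (f ∘ suc) (g ∘ suc) n = interchange (f 0) (g 0) _ _
  where
  interchange : ∀ a b c d → a + b + (c + d) ≡ a + c + (b + d)
  interchange = solve-∀

Σ<-monoʳ : ∀ f {m n} → m ≤ n → Σ< f m ≤ Σ< f n
Σ<-monoʳ f z≤n       = z≤n
Σ<-monoʳ f (s≤s m≤n) = +-monoʳ-≤ (f 0) (Σ<-monoʳ (f ∘ suc) m≤n)

Σ<-truncate : ∀ {f} m n → (∀ i → m ≤ i → f i ≡ 0) → Σ< f n ≤ Σ< f m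
Σ<-truncate m       zero    f≡0 = z≤n
Σ<-truncate zero    (suc n) f≡0 rewrite f≡0 0 z≤n = Σ<-truncate zero n λ i _ → f≡0 (suc i) z≤n
Σ<-truncate {f} (suc m) (suc n) f≡0 = +-monoʳ-≤ (f 0) (Σ<-truncate m n λ i m≤i → f≡0 (suc i) (s≤s m≤i))

Σ<-last : ∀ f n → Σ< f (suc n) ≡ Σ< f n + f n
Σ<-last f zero    = +-comm (f 0) 0
Σ<-last f (suc n) rewrite Σ<-last (f ∘ suc) n = sym (+-assoc (f 0) _ _)

if-yes : ∀ {A B : Set} (d : Dec A) → A → {x y : B} → (if does d then x else y) ≡ x
if-yes (yes _) a = refl
if-yes (no ¬a) a = contradiction a ¬a

if-no : ∀ {A B : Set} (d : Dec A) → ¬ A → {x y : B} → (if does d then x else y) ≡ y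
if-no (yes a) ¬a = contradiction a ¬a
if-no (no _)  ¬a = refl

indicator : ∀ {A : Set} → Dec A → ℕ
indicator d = if does d then 1 else 0

indicator≤1 : ∀ {A : Set} (d : Dec A) → indicator d ≤ 1
indicator≤1 (yes _) = ≤-refl
indicator≤1 (no _)  = z≤n

indicator-⊎ : ∀ {A B C : Set} (a : Dec A) (b : Dec B) (c : Dec C) →
  (A → B ⊎ C) → indicator a ≤ indicator b + indicator c
indicator-⊎ (no _)  b       c       f = z≤n
indicator-⊎ (yes a) (yes _) c       f = s≤s z≤n
indicator-⊎ (yes a) (no ¬b) (yes _) f = ≤-refl
indicator-⊎ (yes a) (no ¬b) (no ¬c) f = contradiction (f a) [ ¬b , ¬c ]′

indicator-mono : ∀ {A B : Set} (a : Dec A) (b : Dec B) → (A → B) → indicator a ≤ indicator b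
indicator-mono (no _)  b f = z≤n
indicator-mono (yes a) b f = ≤-reflexive (sym (if-yes b (f a)))

C*k!*[n∸k]!≡n! : ∀ {n k} → k ≤ n → (n C k) * (k ! * (n ∸ k) !) ≡ n !
C*k!*[n∸k]!≡n! {n} {k} k≤n =
  trans (cong (_* (k ! * (n ∸ k) !)) (nCk≡n!/k![n-k]! k≤n)) (m/n*n≡m (k![n∸k]!∣n! k≤n))
  where instance _ = k !* n ∸ k !≢0

-- Residues of integers modulo P

∣-difference⇒≡ : ∀ {P a b} → a < P → b < P → + P ℤ∣.∣ + a - + b → a ≡ b
∣-difference⇒≡ {P} {a} {b} a<P b<P P∣a-b =
  ℤ.+-injective (ℤ.i-j≡0⇒i≡j (+ a) (+ b) (ℤ.∣i∣≡0⇒i≡0 (small (ℤ∣.∣⇒∣ᵤ P∣a-b) bound)))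
  where
  bound : ℤ.∣ + a - + b ∣ < P
  bound = subst (λ z → ℤ.∣ z ∣ < P) (sym (ℤ.m-n≡m⊖n a b)) (≤-<-trans (ℤ.∣m⊝n∣≤m⊔n a b) (⊔-lub a<P b<P))
  small : ∀ {n} → P ∣ℕ n → n < P → n ≡ 0
  small {zero}  _   _   = refl
  small {suc n} P∣n n<P = contradiction P∣n (>⇒∤ n<P)

module _ (P : ℕ) .{{_ : NonZero P}} where

  ∣r-r%ℕP : ∀ r → + P ℤ∣.∣ r - + (r ℤ.%ℕ P)
  ∣r-r%ℕP r = ℤ∣.divides (r ℤ./ℕ P) (trans (cong (_- + (r ℤ.%ℕ P)) (ℤ.a≡a%ℕn+[a/ℕn]*n r P))
    (cancel (+ (r ℤ.%ℕ P)) _))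
    where
    cancel : ∀ a b → a ℤ.+ b - a ≡ b
    cancel = ℤ-Solver.solve-∀

  %ℕ-cong : ∀ r s → + P ℤ∣.∣ r - s → r ℤ.%ℕ P ≡ s ℤ.%ℕ P
  %ℕ-cong r s P∣r-s = ∣-difference⇒≡ (ℤ.n%ℕd<d r P) (ℤ.n%ℕd<d s P)
    (subst (+ P ℤ∣.∣_) (rearrange r s _ _)
      (ℤ∣.∣m∣n⇒∣m+n P∣r-s (ℤ∣.∣m∣n⇒∣m-n (∣r-r%ℕP s) (∣r-r%ℕP r))))
    where
    rearrange : ∀ r s a b → (r - s) ℤ.+ ((s - b) - (r - a)) ≡ a - b
    rearrange = ℤ-Solver.solve-∀

  -- If the residues of j and i add up to less than P, then that sum is the residue of j + i, so the
  -- indicator is 0. Otherwise the quotient gains one, and the indicator is at most 1.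
  carry-floor : ∀ j i → j / P + i / P + indicator ((j + i) % P <? j % P) ≤ (j + i) / P
  carry-floor j i with j % P + i % P <? P
  ... | yes s<P = ≤-reflexive (begin-equality
    j / P + i / P + indicator ((j + i) % P <? j % P)
      ≡⟨ cong (λ z → j / P + i / P + z) (if-no ((j + i) % P <? j % P)
        (≤⇒≯ (subst (j % P ≤_) (sym (trans (%-distribˡ-+ j i P) (m<n⇒m%n≡m s<P))) (m≤m+n (j % P) _)))) ⟩
    j / P + i / P + 0                                ≡⟨ +-identityʳ _ ⟩
    j / P + i / P                                    ≡⟨ +-distrib-/ j i s<P ⟨
    (j + i) / P                                      ∎)
    where open ≤-Reasoning
  ... | no s≮P = begin
    j / P + i / P + indicator ((j + i) % P <? j % P) ≤⟨ +-monoʳ-≤ _ (indicator≤1 ((j + i) % P <? j % P)) ⟩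
    j / P + i / P + 1                                ≡⟨ m*n/n≡m _ P ⟨
    (j / P + i / P + 1) * P / P                      ≤⟨ /-monoˡ-≤ P (begin
      (j / P + i / P + 1) * P                        ≡⟨ expand (j / P) (i / P) P ⟩
      P + (j / P * P + i / P * P)                    ≤⟨ +-monoˡ-≤ _ (≮⇒≥ s≮P) ⟩
      j % P + i % P + (j / P * P + i / P * P)        ≡⟨ swap (j % P) (i % P) _ _ ⟩
      (j % P + j / P * P) + (i % P + i / P * P)      ≡⟨ cong₂ _+_ (m≡m%n+[m/n]*n j P) (m≡m%n+[m/n]*n i P) ⟨
      j + i                                          ∎) ⟩
    (j + i) / P                                      ∎
    where
    open ≤-Reasoning
    expand : ∀ a b c → (a + b + 1) * c ≡ c + (a * c + b * c)
    expand = solve-∀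
    swap : ∀ a b c d → a + b + (c + d) ≡ (a + c) + (b + d)
    swap = solve-∀

-- Powers of p in factorials and binomial coefficients; carry counts

module Valuation (p : ℕ) (pr : Prime p) where

  instance
    p≢0 : NonZero p
    p≢0 = prime⇒nonZero pr

  open Padic p {{prime⇒nonZero pr}}

  2≤p : 2 ≤ p
  2≤p = nonTrivial⇒n>1 p {{prime⇒nonTrivial pr}}

  p∤1 : ¬ p ∣ℕ 1
  p∤1 = >⇒∤ 2≤p

  1≤p^ : ∀ n → 1 ≤ p ^ n
  1≤p^ n = m^n>0 p n

  n<p^n : ∀ n → n < p ^ n
  n<p^n zero    = s≤s z≤n
  n<p^n (suc n) = begin-strict
    suc n             ≤⟨ n<p^n n ⟩
    p ^ n             ≡⟨ +-identityʳ _ ⟨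
    p ^ n + 0         <⟨ +-monoʳ-< (p ^ n) (≤-trans (1≤p^ n) (m≤m+n _ 0)) ⟩
    2 * p ^ n         ≤⟨ *-monoˡ-≤ (p ^ n) 2≤p ⟩
    p ^ suc n         ∎
    where open ≤-Reasoning

  p∤-* : ∀ {m n} → ¬ p ∣ℕ m → ¬ p ∣ℕ n → ¬ p ∣ℕ m * n
  p∤-* {m} {n} p∤m p∤n p∣mn = [ p∤m , p∤n ]′ (euclidsLemma m n pr p∣mn)

  p^-cancel : ∀ s a {u} → ¬ p ∣ℕ u → p ^ s ∣ℕ a * u → p ^ s ∣ℕ a
  p^-cancel zero    a p∤u d = 1∣ a
  p^-cancel (suc s) a {u} p∤u d with euclidsLemma a u pr (∣-trans (m∣m*n (p ^ s)) d)
  ... | inj₂ p∣u = contradiction p∣u p∤u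
  ... | inj₁ (divides b refl) = subst (p ^ suc s ∣ℕ_) (*-comm p b)
    (*-monoʳ-∣ p (p^-cancel s b p∤u (*-cancelˡ-∣ p (subst (p ^ suc s ∣ℕ_) (rearrange b p u) d))))
    where
    rearrange : ∀ b p u → b * p * u ≡ p * (b * u)
    rearrange = solve-∀

  p^-mono-∣ : ∀ {m n} → m ≤ n → p ^ m ∣ℕ p ^ n
  p^-mono-∣ {m} {n} m≤n = divides (p ^ (n ∸ m))
    (trans (cong (p ^_) (sym (m∸n+n≡m m≤n))) (^-distribˡ-+-* p (n ∸ m) m))

  -- Legendre's formula

  L : ℕ → ℕ
  L n = ∑⌊ n /p^i⌋,i≥ 1

  ⌊⌋≡0 : ∀ {n i} → n ≤ i → ⌊ n /p^ i ⌋ ≡ 0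
  ⌊⌋≡0 {n} {i} n≤i = m<n⇒m/n≡0 {{m^n≢0 p i}} (<-≤-trans (n<p^n n) (^-monoʳ-≤ p n≤i))

  L-extend : ∀ {n N} → n ≤ N → Σ< (λ i → ⌊ n /p^ suc i ⌋) N ≡ L n
  L-extend {n} {N} n≤N = ≤-antisym
    (Σ<-truncate n N λ i n≤i → ⌊⌋≡0 (m≤n⇒m≤1+n n≤i))
    (Σ<-monoʳ (λ i → ⌊ n /p^ suc i ⌋) n≤N)

  ⌊⌋-nested : ∀ n i j → ⌊ ⌊ n /p^ i ⌋ /p^ j ⌋ ≡ ⌊ n /p^ (i + j) ⌋
  ⌊⌋-nested n i j = trans (m/n/o≡m/[n*o] n (p ^ i) (p ^ j)) (/-congʳ (sym (^-distribˡ-+-* p i j)))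
    where instance
      _ = m^n≢0 p i
      _ = m^n≢0 p j
      _ = m^n≢0 p (i + j)
      _ = m*n≢0 (p ^ i) (p ^ j)

  L-step : ∀ n → L n ≡ n / p + L (n / p)
  L-step n = begin
    L n                                                      ≡⟨ L-extend (n≤1+n n) ⟨
    ⌊ n /p^ 1 ⌋ + Σ< (λ i → ⌊ n /p^ suc (suc i) ⌋) n          ≡⟨ cong₂ _+_ first (Σ<-cong rest n) ⟩
    n / p + Σ< (λ i → ⌊ n / p /p^ suc i ⌋) n                 ≡⟨ cong (λ z → n / p + z) (L-extend (m/n≤m n p)) ⟩
    n / p + L (n / p)                                        ∎
    where
    open ≡-Reasoning
    first : ⌊ n /p^ 1 ⌋ ≡ n / p
    first = /-congʳ {{m^n≢0 p 1}} (*-identityʳ p)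
    rest : ∀ i → ⌊ n /p^ suc (suc i) ⌋ ≡ ⌊ n / p /p^ suc i ⌋
    rest i = trans (sym (⌊⌋-nested n 1 (suc i))) (cong (⌊_/p^ suc i ⌋) first)

  -- The m positive multiples of p up to c + mp contribute p^m m!; the other factors are prime to p.
  -- The induction adds one factor at a time, a block of p factors being closed by (m + 1)p.
  [c+m*p]! : ∀ m c → c < p → ∃[ u ] ¬ p ∣ℕ u × (c + m * p) ! ≡ p ^ m * m ! * u
  [c+m*p]! zero zero c<p = 1 , p∤1 , refl
  [c+m*p]! (suc m) zero c<p with [c+m*p]! m (pred p) (subst (suc (pred p) ≤_) (suc-pred p) ≤-refl)
  ... | u , p∤u , eq = u , p∤u , (begin
    (p + m * p) !                              ≡⟨ cong (λ z → (z + m * p) !) (suc-pred p) ⟨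
    (suc (pred p) + m * p) * (pred p + m * p) ! ≡⟨ cong₂ (λ z y → (z + m * p) * y) (suc-pred p) eq ⟩
    (p + m * p) * (p ^ m * m ! * u)            ≡⟨ rearrange p m (p ^ m) (m !) u ⟩
    p ^ suc m * suc m ! * u                    ∎)
    where
    open ≡-Reasoning
    rearrange : ∀ p m a b u → (p + m * p) * (a * b * u) ≡ p * a * (b + m * b) * u
    rearrange = solve-∀
  [c+m*p]! m (suc c) c<p with [c+m*p]! m c (<-trans (n<1+n c) c<p)
  ... | u , p∤u , eq = (suc c + m * p) * u , p∤-* p∤1+c+mp p∤u , (begin
    (suc c + m * p) * (c + m * p) !          ≡⟨ cong ((suc c + m * p) *_) eq ⟩
    (suc c + m * p) * (p ^ m * m ! * u)      ≡⟨ rearrange (suc c + m * p) (p ^ m * m !) u ⟩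
    p ^ m * m ! * ((suc c + m * p) * u)      ∎)
    where
    open ≡-Reasoning
    rearrange : ∀ a b u → a * (b * u) ≡ b * (a * u)
    rearrange = solve-∀
    p∤1+c+mp : ¬ p ∣ℕ suc c + m * p
    p∤1+c+mp d = >⇒∤ c<p (∣m+n∣m⇒∣n (subst (p ∣ℕ_) (+-comm (suc c) (m * p)) d) (n∣m*n m))

  legendre : ∀ n → ∃[ u ] ¬ p ∣ℕ u × n ! ≡ p ^ L n * u
  legendre = <-rec _ step
    where
    go : ∀ n → ∃[ u ] ¬ p ∣ℕ u × (n / p) ! ≡ p ^ L (n / p) * u → ∃[ u ] ¬ p ∣ℕ u × n ! ≡ p ^ L n * u
    go n (u , p∤u , eq) with [c+m*p]! (n / p) (n % p) (m%n<n n p)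
    ... | v , p∤v , eq′ = u * v , p∤-* p∤u p∤v , (begin
      n !                                       ≡⟨ cong _! (m≡m%n+[m/n]*n n p) ⟩
      (n % p + n / p * p) !                     ≡⟨ eq′ ⟩
      p ^ (n / p) * (n / p) ! * v               ≡⟨ cong (λ z → p ^ (n / p) * z * v) eq ⟩
      p ^ (n / p) * (p ^ L (n / p) * u) * v     ≡⟨ rearrange (p ^ (n / p)) _ u v ⟩
      p ^ (n / p) * p ^ L (n / p) * (u * v)     ≡⟨ cong (_* (u * v)) (^-distribˡ-+-* p (n / p) _) ⟨
      p ^ (n / p + L (n / p)) * (u * v)         ≡⟨ cong (λ z → p ^ z * (u * v)) (L-step n) ⟨
      p ^ L n * (u * v)                         ∎)
      where
      open ≡-Reasoning
      rearrange : ∀ a b u v → a * (b * u) * v ≡ a * b * (u * v)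
      rearrange = solve-∀
    step : ∀ n → (∀ {m} → m < n → ∃[ u ] ¬ p ∣ℕ u × m ! ≡ p ^ L m * u) → ∃[ u ] ¬ p ∣ℕ u × n ! ≡ p ^ L n * u
    step zero      rec = 1 , p∤1 , refl
    step n@(suc _) rec = go n (rec (m/n<m n p 2≤p))

  L< : ∀ n .{{_ : NonZero n}} → L n < n
  L< n = <-rec (λ n → 0 < n → L n < n) step n (>-nonZero⁻¹ n)
    where
    open ≤-Reasoning
    step : ∀ n → (∀ {m} → m < n → 0 < m → L m < m) → 0 < n → L n < n
    step n rec 0<n with n / p in eq | L-step n
    ... | zero  | Ln≡ rewrite Ln≡ = 0<n
    ... | suc m | Ln≡ rewrite Ln≡ = begin-strict
      suc m + L (suc m)  <⟨ +-monoʳ-< (suc m) (rec m<n z<s) ⟩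
      suc m + suc m      ≡⟨ cong (λ z → suc m + z) (+-identityʳ (suc m)) ⟨
      2 * suc m          ≤⟨ *-monoˡ-≤ (suc m) 2≤p ⟩
      p * suc m          ≡⟨ cong (p *_) eq ⟨
      p * (n / p)        ≡⟨ *-comm p (n / p) ⟩
      n / p * p          ≤⟨ m/n*n≤m n p ⟩
      n                  ∎
      where
      m<n : suc m < n
      m<n = subst (_< n) eq (m/n<m n p {{>-nonZero 0<n}} 2≤p)

  p^∣C : ∀ {s n k} → k ≤ n → s + (L k + L (n ∸ k)) ≤ L n → p ^ s ∣ℕ n C k
  p^∣C {s} {n} {k} k≤n s≤ with legendre n | legendre k | legendre (n ∸ k)
  ... | u , _ , eq | v , p∤v , eq₁ | w , p∤w , eq₂ =
    p^-cancel s (n C k) (p∤-* p∤v p∤w) (*-cancelʳ-∣ (p ^ (L k + L (n ∸ k))) {{m^n≢0 p (L k + L (n ∸ k))}} (begin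
      p ^ s * p ^ (L k + L (n ∸ k))                    ≡⟨ ^-distribˡ-+-* p s _ ⟨
      p ^ (s + (L k + L (n ∸ k)))                      ∣⟨ p^-mono-∣ s≤ ⟩
      p ^ L n                                          ∣⟨ m∣m*n u ⟩
      p ^ L n * u                                      ≡⟨ eq ⟨
      n !                                              ≡⟨ C*k!*[n∸k]!≡n! k≤n ⟨
      (n C k) * (k ! * (n ∸ k) !)                        ≡⟨ cong₂ (λ y z → (n C k) * (y * z)) eq₁ eq₂ ⟩
      (n C k) * (p ^ L k * v * (p ^ L (n ∸ k) * w))      ≡⟨ rearrange (n C k) (p ^ L k) v (p ^ L (n ∸ k)) w ⟩
      (n C k) * (v * w) * (p ^ L k * p ^ L (n ∸ k))      ≡⟨ cong ((n C k) * (v * w) *_) (^-distribˡ-+-* p (L k) _) ⟨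
      (n C k) * (v * w) * p ^ (L k + L (n ∸ k))          ∎))
    where
    open ∣-Reasoning
    rearrange : ∀ c a v b w → c * (a * v * (b * w)) ≡ c * (v * w) * (a * b)
    rearrange = solve-∀

  -- r mod pⁱ > n mod pⁱ says that adding r and n - r modulo pⁱ carries out of position i - 1.
  -- Hence t β n r is the number of carries out of the β lowest positions; t₀ β r is t β 0 r.

  t : ℕ → ℕ → ℤ → ℕ
  t β n r = Σ< (λ i → indicator ((+ n) %p^ suc i <? r %p^ suc i)) β

  t₀ : ℕ → ℤ → ℕ
  t₀ β r = Σ< (λ i → indicator (¬? (pow (suc i) ∣? r))) β

  -- Legendre's sums compared termwise by `carry-floor`: each carry is a unit that the quotient of
  -- the sum has in excess. For β = 0 this is the superadditivity of `L`.
  kummer : ∀ β {n k} → k ≤ n → t β n (+ k) + (L k + L (n ∸ k)) ≤ L n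
  kummer β {n} {k} k≤n = subst (λ n → t β n (+ k) + (L k + L j) ≤ L n) k+j≡n (begin
    t β (k + j) (+ k) + (L k + L j)    ≤⟨ +-monoˡ-≤ _ (Σ<-monoʳ _ (m≤n+m β (k + j))) ⟩
    t N (k + j) (+ k) + (L k + L j)    ≡⟨ +-comm (t N (k + j) (+ k)) _ ⟩
    L k + L j + t N (k + j) (+ k)
      ≡⟨ cong₂ (λ y z → y + z + t N (k + j) (+ k)) (L-extend (≤-trans (m≤m+n k j) N≥)) (L-extend (≤-trans (m≤n+m j k) N≥)) ⟨
    Σ< (λ i → ⌊ k /p^ suc i ⌋) N + Σ< (λ i → ⌊ j /p^ suc i ⌋) N + t N (k + j) (+ k)
      ≡⟨ cong (_+ t N (k + j) (+ k)) (Σ<-+ (λ i → ⌊ k /p^ suc i ⌋) _ N) ⟨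
    Σ< (λ i → ⌊ k /p^ suc i ⌋ + ⌊ j /p^ suc i ⌋) N + t N (k + j) (+ k)
      ≡⟨ Σ<-+ (λ i → ⌊ k /p^ suc i ⌋ + ⌊ j /p^ suc i ⌋) _ N ⟨
    Σ< (λ i → ⌊ k /p^ suc i ⌋ + ⌊ j /p^ suc i ⌋ + indicator ((+ (k + j)) %p^ suc i <? (+ k) %p^ suc i)) N
      ≤⟨ Σ<-mono N (λ i _ → carry-floor (p ^ suc i) {{m^n≢0 p (suc i)}} k j) ⟩
    Σ< (λ i → ⌊ k + j /p^ suc i ⌋) N   ≡⟨ L-extend N≥ ⟩
    L (k + j)                          ∎)
    where
    open ≤-Reasoning
    j = n ∸ k
    k+j≡n = m+[n∸m]≡n k≤n
    -- A common length: it covers all three Legendre sums and the β carry positions. Positions from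
    -- β on only add to the left side, and `carry-floor` pays for them too.
    N = k + j + β
    N≥ : k + j ≤ N
    N≥ = m≤m+n (k + j) β

  p^t∣C : ∀ β {n k} → k ≤ n → p ^ t β n (+ k) ∣ℕ n C k
  p^t∣C β {n} {k} k≤n = p^∣C {t β n (+ k)} k≤n (kummer β k≤n)

  pow-mono : ∀ {i j} → i ≤ j → pow i ℤ∣.∣ pow j
  pow-mono i≤j = ℤ∣.∣ᵤ⇒∣ (p^-mono-∣ i≤j)

  pow-+ : ∀ i j → pow (i + j) ≡ pow i ℤ.* pow j
  pow-+ i j = trans (cong +_ (^-distribˡ-+-* p i j)) (ℤ.pos-* (p ^ i) (p ^ j))

  -- At a modulus dividing r - k, the residues of r and k agree, so a carry for r is one for k;
  -- every other modulus is counted by `t₀`.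
  t-subadditive : ∀ β n k r → t β n r ≤ t β n (+ k) + t₀ β (r - + k)
  t-subadditive β n k r = ≤-trans
    (Σ<-mono β λ i _ → indicator-⊎ ((+ n) %p^ suc i <? r %p^ suc i) ((+ n) %p^ suc i <? (+ k) %p^ suc i)
      (¬? (pow (suc i) ∣? (r - + k))) (split i))
    (≤-reflexive (Σ<-+ (λ i → indicator ((+ n) %p^ suc i <? (+ k) %p^ suc i)) _ β))
    where
    split : ∀ i → (+ n) %p^ suc i < r %p^ suc i →
      (+ n) %p^ suc i < (+ k) %p^ suc i ⊎ ¬ pow (suc i) ℤ∣.∣ r - + k
    split i n<r with pow (suc i) ∣? (r - + k)
    ... | yes d = inj₁ (subst (_ <_) (%ℕ-cong (p ^ suc i) {{m^n≢0 p (suc i)}} r (+ k) d) n<r)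
    ... | no ¬d = inj₂ ¬d

  -- All residues of n modulo p, ..., p^β are 0, so every nonzero residue of k exceeds that of n.
  t₀≤t : ∀ β {n} → p ^ β ∣ℕ n → ∀ k → t₀ β (+ k) ≤ t β n (+ k)
  t₀≤t β {n} d k = Σ<-mono β λ i i<β → indicator-mono (¬? (pow (suc i) ∣? + k))
    ((+ n) %p^ suc i <? (+ k) %p^ suc i) (go i i<β)
    where
    go : ∀ i → i < β → ¬ pow (suc i) ℤ∣.∣ + k → (+ n) %p^ suc i < (+ k) %p^ suc i
    go i i<β ¬d = subst (_< (+ k) %p^ suc i) (sym (n∣m⇒m%n≡0 n _ {{m^n≢0 p (suc i)}} (∣-trans (ℤ∣.∣⇒∣ᵤ (pow-mono i<β)) d)))
      (n≢0⇒n>0 {n = (+ k) %p^ suc i} λ eq → ¬d (ℤ∣.∣ᵤ⇒∣ (m%n≡0⇒n∣m k _ {{m^n≢0 p (suc i)}} eq)))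

  ∣-pred : ∀ β {r} → pow (suc β) ℤ∣.∣ r → pow β ℤ∣.∣ r
  ∣-pred β = ℤ∣.∣-trans (pow-mono (n≤1+n β))

  t₀-multiple : ∀ β {r} → pow β ℤ∣.∣ r → t₀ β r ≡ 0
  t₀-multiple zero    d = refl
  t₀-multiple (suc β) {r} d = trans (Σ<-last _ β) (cong₂ _+_ (t₀-multiple β (∣-pred β d))
    (if-no (¬? (pow (suc β) ∣? r)) λ ¬d → ¬d d))

  t₀-nonmultiple : ∀ β {r} → ¬ pow (suc β) ℤ∣.∣ r → t₀ (suc β) r ≡ suc (t₀ β r)
  t₀-nonmultiple β {r} ¬d = trans (Σ<-last _ β)
    (trans (cong (λ z → t₀ β r + z) (if-yes (¬? (pow (suc β) ∣? r)) ¬d)) (+-comm _ 1))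

  t₀-suc≤ : ∀ β r → t₀ (suc β) r ≤ suc (t₀ β r)
  t₀-suc≤ β r = begin
    t₀ (suc β) r                                       ≡⟨ Σ<-last _ β ⟩
    t₀ β r + indicator (¬? (pow (suc β) ∣? r))         ≤⟨ +-monoʳ-≤ (t₀ β r) (indicator≤1 (¬? (pow (suc β) ∣? r))) ⟩
    t₀ β r + 1                                         ≡⟨ +-comm (t₀ β r) 1 ⟩
    suc (t₀ β r)                                       ∎
    where open ≤-Reasoning

  -- The ultrametric inequality for ord, as `t₀ β r` = β - min(β, ord r). In the induction, a
  -- multiple of p^(β+1) has count 0 at both levels, and for a nonmultiple the count grows by
  -- exactly one.
  t₀-ultrametric : ∀ β a b → t₀ β (a ℤ.+ b) ≤ t₀ β a ⊔ t₀ β b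
  t₀-ultrametric zero    a b = z≤n
  t₀-ultrametric (suc β) a b with pow (suc β) ∣? a | pow (suc β) ∣? b
  ... | yes da | yes db = ≤-trans (≤-reflexive (t₀-multiple (suc β) (ℤ∣.∣m∣n⇒∣m+n da db))) z≤n
  ... | no ¬da | no ¬db = ≤-trans (t₀-suc≤ β (a ℤ.+ b)) (≤-trans (s≤s (t₀-ultrametric β a b))
    (≤-reflexive (cong₂ _⊔_ (sym (t₀-nonmultiple β ¬da)) (sym (t₀-nonmultiple β ¬db)))))
  ... | no ¬da | yes db = ≤-trans (t₀-suc≤ β (a ℤ.+ b)) (≤-trans (s≤s (t₀-ultrametric β a b)) (begin
    suc (t₀ β a ⊔ t₀ β b)            ≡⟨ cong (λ z → suc (t₀ β a ⊔ z)) (t₀-multiple β (∣-pred β db)) ⟩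
    suc (t₀ β a ⊔ 0)                 ≡⟨ cong suc (⊔-identityʳ (t₀ β a)) ⟩
    suc (t₀ β a)                     ≡⟨ t₀-nonmultiple β ¬da ⟨
    t₀ (suc β) a                     ≤⟨ m≤m⊔n _ _ ⟩
    t₀ (suc β) a ⊔ t₀ (suc β) b      ∎))
    where open ≤-Reasoning
  ... | yes da | no ¬db = ≤-trans (t₀-suc≤ β (a ℤ.+ b)) (≤-trans (s≤s (t₀-ultrametric β a b)) (begin
    suc (t₀ β a ⊔ t₀ β b)            ≡⟨ cong (λ z → suc (z ⊔ t₀ β b)) (t₀-multiple β (∣-pred β da)) ⟩
    suc (t₀ β b)                     ≡⟨ t₀-nonmultiple β ¬db ⟨
    t₀ (suc β) b                     ≤⟨ m≤n⊔m _ _ ⟩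
    t₀ (suc β) a ⊔ t₀ (suc β) b      ∎))
    where open ≤-Reasoning

-- ℤ[X], acting on functions ℤ → ℤ with X as the shift. Pairing A ∈ ℤ[X] with g, by
-- evaluating A · g at 0, replaces Xᵏ by g k; polynomials are equal if they act equally.
infixl 6 _⊕_
infixl 7 _⊗_

data ℤ[X] : Set where
  X       : ℤ[X]
  ⟨_⟩     : ℤ → ℤ[X]
  _⊕_ _⊗_ : ℤ[X] → ℤ[X] → ℤ[X]

act : ℤ[X] → (ℤ → ℤ) → ℤ → ℤ
act X       g k = g (k ℤ.+ 1ℤ)
act ⟨ c ⟩   g k = c ℤ.* g k
act (a ⊕ b) g k = act a g k ℤ.+ act b g k
act (a ⊗ b) g k = act a (act b g) k

infix 4 _≋_
record _≋_ (a b : ℤ[X]) : Set where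
  constructor mk≋
  field act-≡ : ∀ g k → act a g k ≡ act b g k
open _≋_ public

act-cong : ∀ a {g h} → (∀ k → g k ≡ h k) → ∀ k → act a g k ≡ act a h k
act-cong X       e k = e (k ℤ.+ 1ℤ)
act-cong ⟨ c ⟩   e k = cong (c ℤ.*_) (e k)
act-cong (a ⊕ b) e k = cong₂ ℤ._+_ (act-cong a e k) (act-cong b e k)
act-cong (a ⊗ b) e k = act-cong a (act-cong b e) k

act-+ : ∀ a g h k → act a (λ j → g j ℤ.+ h j) k ≡ act a g k ℤ.+ act a h k
act-+ X       g h k = refl
act-+ ⟨ c ⟩   g h k = ℤ.*-distribˡ-+ c (g k) (h k)
act-+ (a ⊕ b) g h k = trans (cong₂ ℤ._+_ (act-+ a g h k) (act-+ b g h k))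
  (interchange (act a g k) (act a h k) (act b g k) (act b h k))
  where
  interchange : ∀ x y z w → (x ℤ.+ y) ℤ.+ (z ℤ.+ w) ≡ (x ℤ.+ z) ℤ.+ (y ℤ.+ w)
  interchange = ℤ-Solver.solve-∀
act-+ (a ⊗ b) g h k = trans (act-cong a (act-+ b g h) k) (act-+ a (act b g) (act b h) k)

act-* : ∀ a c g k → act a (λ j → c ℤ.* g j) k ≡ c ℤ.* act a g k
act-* X       c g k = refl
act-* ⟨ d ⟩   c g k = swap d c (g k)
  where
  swap : ∀ x y z → x ℤ.* (y ℤ.* z) ≡ y ℤ.* (x ℤ.* z)
  swap = ℤ-Solver.solve-∀
act-* (a ⊕ b) c g k = trans (cong₂ ℤ._+_ (act-* a c g k) (act-* b c g k)) (sym (ℤ.*-distribˡ-+ c _ _))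
act-* (a ⊗ b) c g k = trans (act-cong a (act-* b c g) k) (act-* a c (act b g) k)

act-shift : ∀ a s g k → act a (λ j → g (j ℤ.+ s)) k ≡ act a g (k ℤ.+ s)
act-shift X       s g k = cong g (swap k s)
  where
  swap : ∀ x y → x ℤ.+ 1ℤ ℤ.+ y ≡ x ℤ.+ y ℤ.+ 1ℤ
  swap = ℤ-Solver.solve-∀
act-shift ⟨ c ⟩   s g k = refl
act-shift (a ⊕ b) s g k = cong₂ ℤ._+_ (act-shift a s g k) (act-shift b s g k)
act-shift (a ⊗ b) s g k = trans (act-cong a (act-shift b s g) k) (act-shift a s (act b g) k)

-- Every operator is linear (`act-+`, `act-*`) and commutes with translations (`act-shift`), hence
-- with everything built from `X` and constants.
act-comm : ∀ a b g k → act a (act b g) k ≡ act b (act a g) k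
act-comm X       b g k = sym (act-shift b 1ℤ g k)
act-comm ⟨ c ⟩   b g k = sym (act-* b c g k)
act-comm (a ⊕ c) b g k = trans (cong₂ ℤ._+_ (act-comm a b g k) (act-comm c b g k)) (sym (act-+ b (act a g) (act c g) k))
act-comm (a ⊗ c) b g k = trans (act-cong a (act-comm c b g) k) (act-comm a b (act c g) k)

ℤ[X]-isCommutativeRing : IsCommutativeRing _≋_ _⊕_ _⊗_ (⟨ -1ℤ ⟩ ⊗_) ⟨ 0ℤ ⟩ ⟨ 1ℤ ⟩
ℤ[X]-isCommutativeRing = record
  { isRing = record
    { +-isAbelianGroup = record
      { isGroup = record
        { isMonoid = record
          { isSemigroup = record
            { isMagma = record
              { isEquivalence = record
                { refl  = mk≋ λ g k → refl
                ; sym   = λ e → mk≋ λ g k → sym (act-≡ e g k)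
                ; trans = λ e e′ → mk≋ λ g k → trans (act-≡ e g k) (act-≡ e′ g k)
                }
              ; ∙-cong = λ e e′ → mk≋ λ g k → cong₂ ℤ._+_ (act-≡ e g k) (act-≡ e′ g k)
              }
            ; assoc = λ a b c → mk≋ λ g k → ℤ.+-assoc (act a g k) _ _
            }
          ; identity = (λ a → mk≋ λ g k → ℤ.+-identityˡ _) , (λ a → mk≋ λ g k → ℤ.+-identityʳ _)
          }
        ; inverse = (λ a → mk≋ λ g k → -x+x≡0 (act a g k)) , (λ a → mk≋ λ g k → x-x≡0 (act a g k))
        ; ⁻¹-cong = λ e → mk≋ λ g k → cong (-1ℤ ℤ.*_) (act-≡ e g k)
        }
      ; comm = λ a b → mk≋ λ g k → ℤ.+-comm (act a g k) _
      }
    ; *-cong = λ {a} {b} {c} {d} e e′ → mk≋ λ g k → trans (act-cong a (act-≡ e′ g) k) (act-≡ e (act d g) k)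
    ; *-assoc = λ a b c → mk≋ λ g k → refl
    ; *-identity = (λ a → mk≋ λ g k → ℤ.*-identityˡ _) , (λ a → mk≋ λ g k → act-cong a (λ j → ℤ.*-identityˡ (g j)) k)
    ; distrib = (λ a b c → mk≋ λ g k → act-+ a (act b g) (act c g) k) , (λ a b c → mk≋ λ g k → refl)
    }
  ; *-comm = λ a b → mk≋ λ g k → act-comm a b g k
  }
  where
  -x+x≡0 : ∀ x → -1ℤ ℤ.* x ℤ.+ x ≡ 0ℤ
  -x+x≡0 = ℤ-Solver.solve-∀
  x-x≡0 : ∀ x → x ℤ.+ -1ℤ ℤ.* x ≡ 0ℤ
  x-x≡0 = ℤ-Solver.solve-∀

ℤ[X]-commutativeRing : CommutativeRing 0ℓ 0ℓ
ℤ[X]-commutativeRing = record { isCommutativeRing = ℤ[X]-isCommutativeRing }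

-- Binomial expansions in ℤ[X]

module R = CommutativeRing ℤ[X]-commutativeRing
open import Algebra.Definitions.RawMagma using (_,_)
open import Algebra.Properties.CommutativeSemiring.Binomial R.commutativeSemiring
  using () renaming (theorem to binomial-theorem; binomialTerm to binomial-term)
open import Algebra.Properties.CommutativeSemiring.Exp R.commutativeSemiring using (^-distrib-*)
open import Algebra.Properties.Monoid.Mult R.+-monoid using () renaming (_×_ to infixr 8 _×ᴿ_)
open import Algebra.Properties.Monoid.Sum R.+-monoid using (sum-init-last) renaming (sum to ∑ᴿ)
open import Algebra.Properties.Semiring.Exp R.semiring using (^-homo-*; ^-assocʳ; ^-congˡ; ^-congʳ)
  renaming (_^_ to infixr 8 _^ᴿ_)
import Relation.Binary.Reasoning.Setoid R.setoid as ≋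

-- What a predicate needs for passing from the terms of a binomial expansion to the power itself.
record Additive (P : ℤ[X] → Set) : Set where
  field
    ≋-resp   : ∀ {a b} → a ≋ b → P a → P b
    0-closed : P ⟨ 0ℤ ⟩
    ⊕-closed : ∀ {a b} → P a → P b → P (a ⊕ b)

  ∑-closed : ∀ {n} (f : Fin n → ℤ[X]) → (∀ i → P (f i)) → P (∑ᴿ f)
  ∑-closed {zero}  f Pf = 0-closed
  ∑-closed {suc n} f Pf = ⊕-closed (Pf fzero) (∑-closed (f ∘ fsuc) (Pf ∘ fsuc))
open Additive

additive-⊗ : ∀ {P} a → Additive P → Additive (λ b → P (b ⊗ a))
additive-⊗ a add .≋-resp e = add .≋-resp (R.*-congʳ e)
additive-⊗ a add .0-closed  = add .≋-resp (R.sym (R.zeroˡ a)) (add .0-closed)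
additive-⊗ a add .⊕-closed {b} {c} Pb Pc = add .≋-resp (R.sym (R.distribʳ a b c)) (add .⊕-closed Pb Pc)

×≋⟨⟩⊗ : ∀ n a → n ×ᴿ a ≋ ⟨ + n ⟩ ⊗ a
×≋⟨⟩⊗ zero    a = mk≋ λ g k → refl
×≋⟨⟩⊗ (suc n) a = mk≋ λ g k → trans (cong (λ z → act a g k ℤ.+ z) (act-≡ (×≋⟨⟩⊗ n a) g k))
  (sym (ℤ.suc-* (+ n) (act a g k)))

⟨⟩-^ : ∀ c m → ⟨ c ⟩ ^ᴿ m ≋ ⟨ c ℤ.^ m ⟩
⟨⟩-^ c zero    = R.refl
⟨⟩-^ c (suc m) = mk≋ λ g k → trans (cong (c ℤ.*_) (act-≡ (⟨⟩-^ c m) g k)) (sym (ℤ.*-assoc c (c ℤ.^ m) (g k)))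

pos-^ : ∀ n m → (+ n) ℤ.^ m ≡ + (n ^ m)
pos-^ n zero    = refl
pos-^ n (suc m) = trans (cong (+ n ℤ.*_) (pos-^ n m)) (sym (ℤ.pos-* n (n ^ m)))

module Binomial {P : ℤ[X] → Set} (add : Additive P) (n : ℕ) (x y : ℤ[X]) where

  term : ℕ → ℤ[X]
  term k = ⟨ + (n C k) ⟩ ⊗ (x ^ᴿ k ⊗ y ^ᴿ (n ∸ k))

  term-closed : ∀ i → P (term (toℕ i)) → P (binomial-term x y n i)
  term-closed i = add .≋-resp (R.sym (×≋⟨⟩⊗ (n C toℕ i) _))

  all-terms : (∀ k → k ≤ n → P (term k)) → P ((x ⊕ y) ^ᴿ n)
  all-terms Pt = add .≋-resp (R.sym (binomial-theorem n x y))
    (∑-closed add _ λ i → term-closed i (Pt (toℕ i) (s≤s⁻¹ (toℕ<n i))))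

-- The two extreme terms have coefficient 1 and are split off; for n a power of p, the coefficients
-- of the rest are divisible by p.
binomial-middle : ∀ {P : ℤ[X] → Set} (add : Additive P) n .{{_ : NonZero n}} x y →
  (∀ k → 0 < k → k < n → P (Binomial.term add n x y k)) →
  ∃[ m ] P m × (x ⊕ y) ^ᴿ n ≋ (y ^ᴿ n ⊕ m) ⊕ x ^ᴿ n
binomial-middle {P} add (suc n) x y Pt = middle , middle-closed , R.trans (binomial-theorem (suc n) x y)
    (R.trans (sum-init-last (binomial-term x y (suc n))) (R.+-cong (R.+-congʳ first) last′))
  where
  open Binomial add (suc n) x y
  middle = ∑ᴿ (λ (i : Fin n) → binomial-term x y (suc n) (fsuc (inject₁ i)))
  middle-closed : P middle
  middle-closed = ∑-closed add _ λ i → term-closed (fsuc (inject₁ i))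
    (Pt (suc (toℕ (inject₁ i))) z<s (s<s (subst (_< n) (sym (toℕ-inject₁ i)) (toℕ<n i))))
  first : binomial-term x y (suc n) fzero ≋ y ^ᴿ suc n
  first = R.trans (×≋⟨⟩⊗ 1 _) (R.trans (R.*-identityˡ _) (R.*-identityˡ _))
  last′ : binomial-term x y (suc n) (fromℕ (suc n)) ≋ x ^ᴿ suc n
  last′ = R.trans (×≋⟨⟩⊗ (suc n C toℕ (fromℕ (suc n))) _) (subst (λ k → term k ≋ x ^ᴿ suc n) (sym (toℕ-fromℕ (suc n)))
    (begin
      ⟨ + (suc n C suc n) ⟩ ⊗ (x ^ᴿ suc n ⊗ y ^ᴿ (suc n ∸ suc n))
        ≡⟨ cong₂ (λ c m → ⟨ + c ⟩ ⊗ (x ^ᴿ suc n ⊗ y ^ᴿ m)) (nCn≡1 (suc n)) (n∸n≡0 n) ⟩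
      ⟨ 1ℤ ⟩ ⊗ (x ^ᴿ suc n ⊗ ⟨ 1ℤ ⟩)  ≈⟨ R.*-identityˡ _ ⟩
      x ^ᴿ suc n ⊗ ⟨ 1ℤ ⟩             ≈⟨ R.*-identityʳ _ ⟩
      x ^ᴿ suc n                      ∎))
    where open ≋

-- Divided powers relative to a filtration of ℤ[X]

module DividedPowers (p : ℕ) (pr : Prime p)
  (I : ℕ → ℤ[X] → Set)
  (I-additive : ∀ e → Additive (I e))
  (I-scale : ∀ {s e n a} → p ^ s ∣ℕ n → I e a → I (s + e) (⟨ + n ⟩ ⊗ a))
  (I-mono : ∀ {e e′ a} → e′ ≤ e → I e a → I e′ a)
  where

  open Valuation p pr

  Stable : ℤ[X] → Set
  Stable u = ∀ {e a} → I e a → I e (u ⊗ a)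

  stable-^ : ∀ {u} → Stable u → ∀ m → Stable (u ^ᴿ m)
  stable-^ st zero    {e} Ia = I-additive e .≋-resp (R.sym (R.*-identityˡ _)) Ia
  stable-^ st (suc m) {e} Ia = I-additive e .≋-resp (R.sym (R.*-assoc _ _ _)) (st (stable-^ st m Ia))

  stable-additive : Additive Stable
  stable-additive .≋-resp u≋v st {e} Ia = I-additive e .≋-resp (R.*-congʳ u≋v) (st Ia)
  stable-additive .0-closed {e} {a} Ia = I-additive e .≋-resp (R.sym (R.zeroˡ a)) (I-additive e .0-closed)
  stable-additive .⊕-closed st st′ {e} {a} Ia = additive-⊗ a (I-additive e) .⊕-closed (st Ia) (st′ Ia)

  -- wᵐ / (pᶜᵐ m!) preserves the filtration I.
  DP : ℕ → ℤ[X] → ℕ → Set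
  DP c w m = ∀ {e a} → I e a → I (c * m + L m + e) (w ^ᴿ m ⊗ a)

  DP-zero : ∀ c w → DP c w 0
  DP-zero c w {e} Ia = I-additive _ .≋-resp (R.sym (R.*-identityˡ _))
    (I-mono (≤-reflexive (cong (λ z → z + 0 + e) (*-zeroʳ c))) Ia)

  DP-resp : ∀ c m {w w′} → w ≋ w′ → DP c w m → DP c w′ m
  DP-resp c m w≋w′ dp Ia = I-additive _ .≋-resp (R.*-congʳ (^-congˡ m w≋w′)) (dp Ia)

  -- The divided power of a sum is the sum of the products of divided powers: C(m, k) supplies the
  -- p's by which m! exceeds k! (m - k)!.
  DP-+ : ∀ {c w w′} m → (∀ k → k ≤ m → DP c w k) → (∀ k → k ≤ m → DP c w′ k) → DP c (w ⊕ w′) m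
  DP-+ {c} {w} {w′} m dp dp′ {e} {a} Ia = Binomial.all-terms (additive-⊗ a (I-additive _)) m w w′ λ k k≤m →
    I-additive _ .≋-resp (mk≋ λ g k → refl) (I-mono (≤-reflexive (exponent k k≤m)) (I-scale {L m ∸ (L k + L (m ∸ k))}
      (p^∣C {L m ∸ (L k + L (m ∸ k))} k≤m (≤-reflexive (m∸n+n≡m (kummer 0 k≤m))))
      (dp k k≤m (dp′ (m ∸ k) (m∸n≤m m k) Ia))))
    where
    open ≡-Reasoning
    rearrange : ∀ c k j e s l l′ → c * (k + j) + (s + (l + l′)) + e ≡ s + (c * k + l + (c * j + l′ + e))
    rearrange = solve-∀
    exponent : ∀ k → k ≤ m → c * m + L m + e ≡ (L m ∸ (L k + L (m ∸ k))) + (c * k + L k + (c * (m ∸ k) + L (m ∸ k) + e))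
    exponent k k≤m = begin
      c * m + L m + e ≡⟨ cong₂ (λ y z → c * y + z + e) (m+[n∸m]≡n k≤m) (m∸n+n≡m (kummer 0 k≤m)) ⟨
      c * (k + (m ∸ k)) + (L m ∸ (L k + L (m ∸ k)) + (L k + L (m ∸ k))) + e ≡⟨
        rearrange c k (m ∸ k) e (L m ∸ (L k + L (m ∸ k))) (L k) (L (m ∸ k)) ⟩
      _ ∎

  DP-⊗ : ∀ c m {u w} → Stable u → DP c w m → DP c (w ⊗ u) m
  DP-⊗ c m {u} {w} st dp {e} Ia = I-additive _ .≋-resp (R.*-congʳ (R.sym (^-distrib-* w u m)))
    (I-additive _ .≋-resp (R.sym (R.*-assoc _ _ _)) (dp (stable-^ st m Ia)))

  DP-p : ∀ m {w} → DP 0 w m → DP 1 (⟨ + p ⟩ ⊗ w) m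
  DP-p m {w} dp {e} {a} Ia = I-additive _ .≋-resp eq
    (I-mono (≤-reflexive (exponent m (L m) e)) (I-scale {m} {n = p ^ m} ∣-refl (dp Ia)))
    where
    exponent : ∀ m l e → 1 * m + l + e ≡ m + (l + e)
    exponent = solve-∀
    ⟨p⟩^m : ⟨ + p ⟩ ^ᴿ m ≋ ⟨ + (p ^ m) ⟩
    ⟨p⟩^m = R.trans (⟨⟩-^ (+ p) m) (R.reflexive (cong ⟨_⟩ (pos-^ p m)))
    eq : ⟨ + (p ^ m) ⟩ ⊗ (w ^ᴿ m ⊗ a) ≋ (⟨ + p ⟩ ⊗ w) ^ᴿ m ⊗ a
    eq = R.trans (R.sym (R.*-assoc _ _ _)) (R.*-congʳ (R.trans (R.*-congʳ (R.sym ⟨p⟩^m)) (R.sym (^-distrib-* ⟨ + p ⟩ w m))))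

  -- For m = c + m′p, wᵐ = wᶜ (wᵖ)ᵐ′ and L m = m′ + L m′, so divided powers of w up to m′ give those up to m.
  DP-root : ∀ {z w u} → w ^ᴿ p ≋ z ⊕ ⟨ + p ⟩ ⊗ (w ⊗ u) → (∀ m → DP 1 z m) → Stable w → Stable u → ∀ m → DP 0 w m
  DP-root {z} {w} {u} w^p≋ dp st-w st-u = <-rec _ step
    where
    step : ∀ m → (∀ {k} → k < m → DP 0 w k) → DP 0 w m
    step zero      rec = DP-zero 0 w
    step m@(suc _) rec {e} {a} Ia = I-additive _ .≋-resp eq
        (I-mono (≤-reflexive (cong (_+ e) (trans (L-step m) (cong (_+ L (m / p)) (sym (*-identityˡ (m / p)))))))
          (dp-w^p (stable-^ st-w (m % p) Ia)))
      where
      dp-w^p : DP 1 (w ^ᴿ p) (m / p)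
      dp-w^p = DP-resp 1 (m / p) (R.sym w^p≋) (DP-+ {1} (m / p) (λ k _ → dp k) λ k k≤ →
        DP-p k (DP-⊗ 0 k st-u (rec (≤-<-trans k≤ (m/n<m m p 2≤p)))))
      eq : (w ^ᴿ p) ^ᴿ (m / p) ⊗ (w ^ᴿ (m % p) ⊗ a) ≋ w ^ᴿ m ⊗ a
      eq = R.trans (R.sym (R.*-assoc _ _ _)) (R.*-congʳ {a} (R.trans (R.*-comm _ _) (R.trans (R.*-congˡ (^-assocʳ w p (m / p)))
        (R.trans (R.sym (^-homo-* w (m % p) (p * (m / p)))) (^-congʳ w
          (trans (cong (λ z → m % p + z) (*-comm p (m / p))) (sym (m≡m%n+[m/n]*n m p))))))))

  -- As L m < m for m > 0, the first factor w need not gain anything.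
  DP-tail : ∀ {w} (I⁺ : ℕ → ℤ[X] → Set) → (∀ {e a b} → a ≋ b → I⁺ e a → I⁺ e b) →
    (∀ {e a} → I e a → I⁺ e (w ⊗ a)) → (∀ {e a} → I⁺ e a → I⁺ (suc e) (w ⊗ a)) →
    (∀ {e a} → I⁺ e a → I e a) → ∀ m → DP 0 w m
  DP-tail {w} I⁺ I⁺-resp into up out zero = DP-zero 0 w
  DP-tail {w} I⁺ I⁺-resp into up out (suc m) {e} {a} Ia =
    I-mono (+-monoˡ-≤ e (s≤s⁻¹ (L< (suc m)))) (out (powers m))
    where
    powers : ∀ m → I⁺ (m + e) (w ^ᴿ suc m ⊗ a)
    powers zero    = I⁺-resp (R.sym (R.*-assoc _ _ _)) (into (I-additive _ .≋-resp (R.sym (R.*-identityˡ _)) Ia))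
    powers (suc m) = I⁺-resp (R.sym (R.*-assoc _ _ _)) (up (powers m))

-- Falling factorials

falling : ℕ → ℤ → ℤ
falling zero    d   = 1ℤ
falling (suc l) d = falling l d ℤ.* (d - + l)

falling-suc : ∀ d l → falling (suc l) (d ℤ.+ 1ℤ) ≡ (d ℤ.+ 1ℤ) ℤ.* falling l d
falling-suc d zero    = base d
  where
  base : ∀ d → 1ℤ ℤ.* (d ℤ.+ 1ℤ - 0ℤ) ≡ (d ℤ.+ 1ℤ) ℤ.* 1ℤ
  base = ℤ-Solver.solve-∀
falling-suc d (suc l) = trans (cong (ℤ._* (d ℤ.+ 1ℤ - + suc l)) (falling-suc d l)) (step d (falling l d) (+ l))
  where
  step : ∀ d f l → (d ℤ.+ 1ℤ) ℤ.* f ℤ.* (d ℤ.+ 1ℤ - (1ℤ ℤ.+ l)) ≡ (d ℤ.+ 1ℤ) ℤ.* (f ℤ.* (d - l))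
  step = ℤ-Solver.solve-∀

-- The reason for using falling factorials instead of powers as weights: a difference is a multiple
-- of a single weight of the next lower degree.
falling-Δ : ∀ d l → falling (suc l) (d ℤ.+ 1ℤ) ℤ.+ -1ℤ ℤ.* falling (suc l) d ≡ + suc l ℤ.* falling l d
falling-Δ d l = trans (cong (ℤ._+ -1ℤ ℤ.* falling (suc l) d) (falling-suc d l)) (expand d (falling l d) (+ l))
  where
  expand : ∀ d f l → (d ℤ.+ 1ℤ) ℤ.* f ℤ.+ -1ℤ ℤ.* (f ℤ.* (d - l)) ≡ (1ℤ ℤ.+ l) ℤ.* f
  expand = ℤ-Solver.solve-∀

fallingℕ : ℕ → ℕ → ℕ
fallingℕ l       zero    = 1
fallingℕ zero    (suc j) = 0
fallingℕ (suc l) (suc j) = suc l * fallingℕ l j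

-- The recursion at the other end, with last factor l - j. Written without subtraction, it also
-- covers j > l, where both falling factorials vanish.
fallingℕ-last : ∀ l j → fallingℕ l (suc j) + j * fallingℕ l j ≡ l * fallingℕ l j
fallingℕ-last zero    zero    = refl
fallingℕ-last (suc l) zero    = +-identityʳ _
fallingℕ-last zero    (suc j) = *-zeroʳ (suc j)
fallingℕ-last (suc l) (suc j) = trans (rearrange l j (fallingℕ l (suc j)) (fallingℕ l j))
  (trans (cong (λ z → suc l * (z + fallingℕ l j)) (fallingℕ-last l j)) (final l (fallingℕ l j)))
  where
  rearrange : ∀ l j a b → suc l * a + suc j * (suc l * b) ≡ suc l * (a + j * b + b)
  rearrange = solve-∀
  final : ∀ l b → suc l * (l * b + b) ≡ suc l * (suc l * b)
  final = solve-∀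

-- `fallingℕ l j` is j! C(l, j). The induction is Pascal's rule multiplied by (j + 1)!.
!∣fallingℕ : ∀ j l → j ! ∣ℕ fallingℕ l j
!∣fallingℕ zero    l       = 1∣ 1
!∣fallingℕ (suc j) zero    = (suc j !) ∣0
!∣fallingℕ (suc j) (suc l) = subst (suc j ! ∣ℕ_)
  (trans (rearrange (fallingℕ l (suc j)) j (fallingℕ l j))
    (trans (cong (_+ fallingℕ l j) (fallingℕ-last l j)) (+-comm _ (fallingℕ l j))))
  (∣m∣n⇒∣m+n (!∣fallingℕ (suc j) l) (*-monoʳ-∣ (suc j) (!∣fallingℕ j l)))
  where
  rearrange : ∀ a j b → a + suc j * b ≡ a + j * b + b
  rearrange = solve-∀

act-X^ : ∀ s g k → act (X ^ᴿ s) g k ≡ g (k ℤ.+ + s)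
act-X^ zero    g k = trans (ℤ.*-identityˡ (g k)) (cong g (sym (ℤ.+-identityʳ k)))
act-X^ (suc s) g k = trans (act-X^ s g (k ℤ.+ 1ℤ)) (cong g (ℤ.+-assoc k 1ℤ (+ s)))

/ℕ-exact : ∀ d P .{{_ : NonZero P}} → (d ℤ.* + P) ℤ./ℕ P ≡ d
/ℕ-exact d P = sym (ℤ.*-cancelʳ-≡ d _ (+ P) (trans (ℤ.a≡a%ℕn+[a/ℕn]*n (d ℤ.* + P) P)
  (trans (cong (λ z → + z ℤ.+ (d ℤ.* + P) ℤ./ℕ P ℤ.* + P) rem≡0) (ℤ.+-identityˡ _))))
  where
  rem≡0 : (d ℤ.* + P) ℤ.%ℕ P ≡ 0
  rem≡0 = trans (%ℕ-cong P (d ℤ.* + P) 0ℤ (ℤ∣.divides d (ℤ.+-identityʳ _))) (0%n≡0 P)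
    where
    0%n≡0 : ∀ n .{{_ : NonZero n}} → 0 % n ≡ 0
    0%n≡0 (suc n) = refl

∣-*-cong : ∀ {a b c d} → a ℤ∣.∣ b → c ℤ∣.∣ d → a ℤ.* c ℤ∣.∣ b ℤ.* d
∣-*-cong {a} {b} {c} {d} a∣b c∣d = ℤ∣.∣-trans (ℤ∣.*-monoˡ-∣ c a∣b) (ℤ∣.*-monoʳ-∣ b c∣d)

-- Pairing polynomials with weights on a residue class

module Coefficients (p : ℕ) (pr : Prime p) (α : ℕ) where
  open Valuation p pr
  open Padic p {{prime⇒nonZero pr}}

  onMultiples : (ℤ → ℤ) → ℤ → ℤ
  onMultiples h x = if does (pow α ∣? x) then h ⌊ x /p^ α ⌋ℤ else 0ℤ

  onMultiples-yes : ∀ h d → onMultiples h (d ℤ.* pow α) ≡ h d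
  onMultiples-yes h d = trans (if-yes (pow α ∣? (d ℤ.* pow α)) (ℤ∣.divides d refl))
    (cong h (/ℕ-exact d (p ^ α) {{m^n≢0 p α}}))

  onMultiples-no : ∀ h {x} → ¬ pow α ℤ∣.∣ x → onMultiples h x ≡ 0ℤ
  onMultiples-no h {x} ¬d = if-no (pow α ∣? x) ¬d

  onMultiples-+ : ∀ g h x → onMultiples (λ d → g d ℤ.+ h d) x ≡ onMultiples g x ℤ.+ onMultiples h x
  onMultiples-+ g h x = if-+ (does (pow α ∣? x))
    where
    if-+ : ∀ b {u v : ℤ} → (if b then u ℤ.+ v else 0ℤ) ≡ (if b then u else 0ℤ) ℤ.+ (if b then v else 0ℤ)
    if-+ true  = refl
    if-+ false = refl

  onMultiples-* : ∀ c h x → onMultiples (λ d → c ℤ.* h d) x ≡ c ℤ.* onMultiples h x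
  onMultiples-* c h x = if-* (does (pow α ∣? x))
    where
    if-* : ∀ b {u : ℤ} → (if b then c ℤ.* u else 0ℤ) ≡ c ℤ.* (if b then u else 0ℤ)
    if-* true  = refl
    if-* false = sym (ℤ.*-zeroʳ c)

  onMultiples-cong : ∀ {g h} → (∀ d → g d ≡ h d) → ∀ x → onMultiples g x ≡ onMultiples h x
  onMultiples-cong g≡h x = cong (λ y → if does (pow α ∣? x) then y else 0ℤ) (g≡h ⌊ x /p^ α ⌋ℤ)

  onMultiples-step : ∀ h x → onMultiples h (x ℤ.+ pow α) ≡ onMultiples (λ d → h (d ℤ.+ 1ℤ)) x
  onMultiples-step h x with pow α ∣? x
  ... | yes (ℤ∣.divides d refl) = trans (cong (onMultiples h) (suc* d (pow α)))
    (trans (onMultiples-yes h (d ℤ.+ 1ℤ)) (sym (onMultiples-yes (λ d → h (d ℤ.+ 1ℤ)) d)))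
    where
    suc* : ∀ d P → d ℤ.* P ℤ.+ P ≡ (d ℤ.+ 1ℤ) ℤ.* P
    suc* = ℤ-Solver.solve-∀
  ... | no ¬d = trans (onMultiples-no h λ d → ¬d (ℤ∣.∣m+n∣n⇒∣m d ℤ∣.∣-refl)) (sym (onMultiples-no (λ d → h (d ℤ.+ 1ℤ)) ¬d))

  -- ⟪ ∑ aₖ Xᵏ , r , h ⟫ = ∑ aₖ h((k - r) / p^α), summed over k ≡ r (mod p^α)
  ⟪_,_,_⟫ : ℤ[X] → ℤ → (ℤ → ℤ) → ℤ
  ⟪ A , r , h ⟫ = act A (λ k → onMultiples h (k - r)) 0ℤ

  ⟪⟫-cong : ∀ A r {g h} → (∀ d → g d ≡ h d) → ⟪ A , r , g ⟫ ≡ ⟪ A , r , h ⟫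
  ⟪⟫-cong A r e = act-cong A (λ k → onMultiples-cong e (k - r)) 0ℤ

  ⟪⟫-+ : ∀ A r g h → ⟪ A , r , (λ d → g d ℤ.+ h d) ⟫ ≡ ⟪ A , r , g ⟫ ℤ.+ ⟪ A , r , h ⟫
  ⟪⟫-+ A r g h = trans (act-cong A (λ k → onMultiples-+ g h (k - r)) 0ℤ) (act-+ A _ _ 0ℤ)

  ⟪⟫-* : ∀ A r c h → ⟪ A , r , (λ d → c ℤ.* h d) ⟫ ≡ c ℤ.* ⟪ A , r , h ⟫
  ⟪⟫-* A r c h = trans (act-cong A (λ k → onMultiples-* c h (k - r)) 0ℤ) (act-* A c _ 0ℤ)

  ⟪⟫-shift : ∀ s A r h → ⟪ X ^ᴿ s ⊗ A , r , h ⟫ ≡ ⟪ A , r - + s , h ⟫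
  ⟪⟫-shift s A r h = trans (act-comm (X ^ᴿ s) A _ 0ℤ)
    (act-cong A (λ k → trans (act-X^ s (λ k → onMultiples h (k - r)) k) (cong (onMultiples h) (rearrange k (+ s) r))) 0ℤ)
    where
    rearrange : ∀ k s r → k ℤ.+ s - r ≡ k - (r - s)
    rearrange = ℤ-Solver.solve-∀

  z : ℤ[X]
  z = X ^ᴿ (p ^ α) ⊕ ⟨ -1ℤ ⟩

  ⟪⟫-z : ∀ A r h → ⟪ z ⊗ A , r , h ⟫ ≡ ⟪ A , r , (λ d → h (d ℤ.+ 1ℤ) ℤ.+ -1ℤ ℤ.* h d) ⟫
  ⟪⟫-z A r h = begin
    ⟪ X ^ᴿ (p ^ α) ⊗ A , r , h ⟫ ℤ.+ -1ℤ ℤ.* ⟪ A , r , h ⟫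
      ≡⟨ cong₂ ℤ._+_ (trans (⟪⟫-shift (p ^ α) A r h) (act-cong A (λ k →
           trans (cong (onMultiples h) (rearrange k (pow α) r)) (onMultiples-step h (k - r))) 0ℤ)) (sym (⟪⟫-* A r -1ℤ h)) ⟩
    ⟪ A , r , (λ d → h (d ℤ.+ 1ℤ)) ⟫ ℤ.+ ⟪ A , r , (λ d → -1ℤ ℤ.* h d) ⟫
      ≡⟨ ⟪⟫-+ A r (λ d → h (d ℤ.+ 1ℤ)) (λ d → -1ℤ ℤ.* h d) ⟨
    ⟪ A , r , (λ d → h (d ℤ.+ 1ℤ) ℤ.+ -1ℤ ℤ.* h d) ⟫ ∎
    where
    open ≡-Reasoning
    rearrange : ∀ k s r → k - (r - s) ≡ k - r ℤ.+ s
    rearrange = ℤ-Solver.solve-∀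

  p⁰∣ : ∀ x → pow 0 ℤ∣.∣ x
  p⁰∣ x = ℤ∣.∣ᵤ⇒∣ (1∣ _)

  -- z lowers the degree l of the weight by one, so the factor pˡ turns every application of z into a gain of p.
  record J (T : ℤ → ℕ) (A : ℤ[X]) : Set where
    constructor mkJ
    field divisible : ∀ r l → pow (T r) ℤ∣.∣ pow l ℤ.* ⟪ A , r , falling l ⟫
  open J public

  J-additive : ∀ T → Additive (J T)
  J-additive T .≋-resp e JA .divisible r l = subst (λ y → pow (T r) ℤ∣.∣ pow l ℤ.* y) (act-≡ e _ 0ℤ) (JA .divisible r l)
  J-additive T .0-closed .divisible r l = subst (pow (T r) ℤ∣.∣_) (sym (ℤ.*-zeroʳ (pow l))) (ℤ∣.divides 0ℤ refl)
  J-additive T .⊕-closed JA JB .divisible r l = subst (pow (T r) ℤ∣.∣_)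
    (sym (ℤ.*-distribˡ-+ (pow l) _ _)) (ℤ∣.∣m∣n⇒∣m+n (JA .divisible r l) (JB .divisible r l))

  J-mono : ∀ {T T′ A} → (∀ r → T′ r ≤ T r) → J T A → J T′ A
  J-mono T′≤T JA .divisible r l = ℤ∣.∣-trans (pow-mono (T′≤T r)) (JA .divisible r l)

  J-⟨⟩ : ∀ {T A} c → J T A → J T (⟨ c ⟩ ⊗ A)
  J-⟨⟩ {T} {A} c JA .divisible r l = subst (pow (T r) ℤ∣.∣_) (swap c (pow l) _) (ℤ∣.∣n⇒∣m*n c (JA .divisible r l))
    where
    swap : ∀ a b c → a ℤ.* (b ℤ.* c) ≡ b ℤ.* (a ℤ.* c)
    swap = ℤ-Solver.solve-∀

  J-scale : ∀ s {n T T′ A} → p ^ s ∣ℕ n → (∀ r → T′ r ≤ s + T r) → J T A → J T′ (⟨ + n ⟩ ⊗ A)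
  J-scale s {n} {T} {T′} {A} d T′≤ JA = J-mono {λ r → s + T r} {T′} {⟨ + n ⟩ ⊗ A} T′≤ (mkJ λ r l →
    subst₂ ℤ∣._∣_ (sym (pow-+ s (T r))) (swap (+ n) (pow l) _) (∣-*-cong (ℤ∣.∣ᵤ⇒∣ {pow s} {+ n} d) (JA .divisible r l)))
    where
    swap : ∀ a b c → a ℤ.* (b ℤ.* c) ≡ b ℤ.* (a ℤ.* c)
    swap = ℤ-Solver.solve-∀

  J-shift : ∀ s {T T′ A} → (∀ r → T′ r ≤ T (r - + s)) → J T A → J T′ (X ^ᴿ s ⊗ A)
  J-shift s {T} {T′} {A} T′≤ JA .divisible r l = ℤ∣.∣-trans (pow-mono (T′≤ r))
    (subst (λ y → pow (T (r - + s)) ℤ∣.∣ pow l ℤ.* y) (sym (⟪⟫-shift s A r (falling l))) (JA .divisible (r - + s) l))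

  -- The j-th difference of `falling l` is `fallingℕ l j` times `falling (l - j)`. Of the factor
  -- p^l, p^(l-j) is used by the hypothesis on `A`, and p^j is left as gain; j! divides the
  -- coefficient.
  J-z^ : ∀ {T A} j → J T A → J (λ r → j + L j + T r) (z ^ᴿ j ⊗ A)
  J-z^ {T} {A} j JA .divisible r l = ℤ∣.∣-trans (subst₂ ℤ∣._∣_ (sym exponent) (ℤ.*-comm (pow j ℤ.* + fallingℕ l j) (pow (T r)))
      (ℤ∣.*-monoˡ-∣ (pow (T r)) (ℤ∣.*-monoʳ-∣ (pow j) (ℤ∣.∣ᵤ⇒∣ (∣-trans p^L∣! (!∣fallingℕ j l))))))
      (powers j l)
    where
    p^L∣! : p ^ L j ∣ℕ j !
    p^L∣! with legendre j
    ... | u , _ , eq = subst (p ^ L j ∣ℕ_) (sym eq) (m∣m*n u)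
    exponent : pow (j + L j + T r) ≡ pow j ℤ.* pow (L j) ℤ.* pow (T r)
    exponent = trans (pow-+ (j + L j) (T r)) (cong (ℤ._* pow (T r)) (pow-+ j (L j)))
    N = pow (T r)
    powers : ∀ j l → N ℤ.* (pow j ℤ.* + fallingℕ l j) ℤ∣.∣ pow l ℤ.* ⟪ z ^ᴿ j ⊗ A , r , falling l ⟫
    powers zero    l = subst₂ ℤ∣._∣_ (sym (ℤ.*-identityʳ N)) (cong (pow l ℤ.*_) (sym (ℤ.*-identityˡ _))) (JA .divisible r l)
    -- Here the divisor is 0, so the pairing itself must vanish: it involves the difference of a
    -- constant.
    powers (suc j) zero = subst (N ℤ.* (pow (suc j) ℤ.* 0ℤ) ℤ∣.∣_) (sym vanish) (ℤ∣.divides 0ℤ refl)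
      where
      vanish : pow 0 ℤ.* ⟪ z ^ᴿ suc j ⊗ A , r , (λ d → 1ℤ) ⟫ ≡ 0ℤ
      vanish = cong (pow 0 ℤ.*_) (trans (⟪⟫-z (z ^ᴿ j ⊗ A) r (λ _ → 1ℤ)) (⟪⟫-* (z ^ᴿ j ⊗ A) r 0ℤ (λ _ → 0ℤ)))
    powers (suc j) (suc l) = subst₂ ℤ∣._∣_
      (trans (lhs (+ p) (+ suc l) N (pow j) (+ fallingℕ l j))
        (sym (cong₂ (λ y w → N ℤ.* (y ℤ.* w)) (ℤ.pos-* p (p ^ j)) (ℤ.pos-* (suc l) (fallingℕ l j)))))
      (trans (rhs (+ p) (+ suc l) (pow l) _) (cong₂ ℤ._*_ (sym (ℤ.pos-* p (p ^ l))) (sym ⟪z⊗⟫)))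
      (ℤ∣.*-monoʳ-∣ (+ p ℤ.* + suc l) (powers j l))
      where
      ⟪z⊗⟫ : ⟪ z ^ᴿ suc j ⊗ A , r , (falling (suc l)) ⟫ ≡ + suc l ℤ.* ⟪ z ^ᴿ j ⊗ A , r , falling l ⟫
      ⟪z⊗⟫ = trans (⟪⟫-z (z ^ᴿ j ⊗ A) r (falling (suc l)))
        (trans (⟪⟫-cong (z ^ᴿ j ⊗ A) r λ d → falling-Δ d l) (⟪⟫-* (z ^ᴿ j ⊗ A) r (+ suc l) (falling l)))
      lhs : ∀ p l n a f → (p ℤ.* l) ℤ.* (n ℤ.* (a ℤ.* f)) ≡ n ℤ.* ((p ℤ.* a) ℤ.* (l ℤ.* f))
      lhs = ℤ-Solver.solve-∀
      rhs : ∀ p l a b → (p ℤ.* l) ℤ.* (a ℤ.* b) ≡ (p ℤ.* a) ℤ.* (l ℤ.* b)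
      rhs = ℤ-Solver.solve-∀

-- Powers of X - 1

-1^-parity : ∀ n → -1ℤ ℤ.^ n ≡ -1ℤ ⊎ (-1ℤ ℤ.^ n ≡ 1ℤ × 2 ∣ℕ n)
-1^-parity zero          = inj₂ (refl , 2 ∣0)
-1^-parity (suc zero)    = inj₁ refl
-1^-parity (suc (suc n)) with -1^-parity n
... | inj₁ eq         = inj₁ (cong (λ x → -1ℤ ℤ.* (-1ℤ ℤ.* x)) eq)
... | inj₂ (eq , 2∣n) = inj₂ (cong (λ x → -1ℤ ℤ.* (-1ℤ ℤ.* x)) eq , ∣m∣n⇒∣m+n ∣-refl 2∣n)

prime∣^⇒prime∣ : ∀ {q m} → Prime q → ∀ n → q ∣ℕ m ^ n → q ∣ℕ m
prime∣^⇒prime∣ pr zero    q∣1 = contradiction (subst Prime (∣1⇒≡1 q∣1) pr) ¬prime[1]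
prime∣^⇒prime∣ {m = m} pr (suc n) d = [ (λ q∣m → q∣m) , prime∣^⇒prime∣ pr n ]′ (euclidsLemma m (m ^ n) pr d)

≤-⊔⇒≤-+ : ∀ {t x d} → 1 ≤ d → t ≤ x ⊔ d → 1 ⊔ t ≤ d + x
≤-⊔⇒≤-+ {x = x} {d} 1≤d t≤ = ⊔-lub (m≤n⇒m≤n+o x 1≤d) (≤-trans t≤ (⊔-lub (m≤n+m x d) (m≤m+n d x)))

-- A sum of two positive integers exceeds their maximum; the 1 in 1 ⊔ x ensures positivity. This is
-- where each further factor w gains its p.
≤-⊔⇒<-+ : ∀ {t x d} → 1 ≤ d → t ≤ x ⊔ d → 1 ⊔ t < d + (1 ⊔ x)
≤-⊔⇒<-+ {t} {x} {d} 1≤d t≤ = begin-strict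
  1 ⊔ t           ≤⟨ ⊔-lub (m≤n⇒m≤n⊔o d (m≤m⊔n 1 x)) (≤-trans t≤ (⊔-monoˡ-≤ d (m≤n⊔m 1 x))) ⟩
  (1 ⊔ x) ⊔ d     <⟨ ⊔-pres-<m (+-monoˡ-≤ (1 ⊔ x) 1≤d) d< ⟩
  d + (1 ⊔ x)     ∎
  where
  open ≤-Reasoning
  d< : d < d + (1 ⊔ x)
  d< = ≤-trans (≤-reflexive (+-comm 1 d)) (+-monoʳ-≤ d (m≤m⊔n 1 x))

module PowersOf[X-1] (p : ℕ) (pr : Prime p) where
  open Valuation p pr
  open Padic p {{prime⇒nonZero pr}}

  -- The constant term of (X - 1)^Q - (X^Q - 1). It is 0 for odd Q, and 2 for even Q, which forces p
  -- = 2.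
  p∣-1^p^β+1 : ∀ β → ∃[ c ] p ∣ℕ c × -1ℤ ℤ.^ (p ^ β) ℤ.+ 1ℤ ≡ + c
  p∣-1^p^β+1 β with -1^-parity (p ^ β)
  ... | inj₁ eq           = 0 , p ∣0 , cong (ℤ._+ 1ℤ) eq
  ... | inj₂ (eq , 2∣p^β) = 2 , p∣2 , cong (ℤ._+ 1ℤ) eq
    where
    p∣2 : p ∣ℕ 2
    p∣2 with prime⇒irreducible pr (prime∣^⇒prime∣ prime[2] β 2∣p^β)
    ... | inj₂ 2≡p = ∣-reflexive (sym 2≡p)

  p^t₀∣C : ∀ β {n k} → p ^ β ∣ℕ n → k ≤ n → p ^ t₀ β (+ k) ∣ℕ n C k
  p^t₀∣C β {n} {k} d k≤n = ∣-trans (p^-mono-∣ (t₀≤t β d k)) (p^t∣C β k≤n)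

  t₀>0 : ∀ β {k} → 0 < k → k < p ^ β → 0 < t₀ β (+ k)
  t₀>0 zero    (s≤s _) (s≤s ())
  t₀>0 (suc β) {suc k} 0<k k<p^ = subst (0 <_) (sym (t₀-nonmultiple β {+ suc k} λ d → >⇒∤ k<p^ (ℤ∣.∣⇒∣ᵤ d))) z<s

  p∣p^C : ∀ β {k} → 0 < k → k < p ^ β → p ∣ℕ (p ^ β) C k
  p∣p^C β {k} 0<k k<p^ = ∣-trans (subst (_∣ℕ p ^ t₀ β (+ k)) (*-identityʳ p) (p^-mono-∣ (t₀>0 β 0<k k<p^)))
    (p^t₀∣C β ∣-refl (<⇒≤ k<p^))

  p∣C : ∀ {k} → 0 < k → k < p → p ∣ℕ p C k
  p∣C {k} 0<k k<p = subst (λ q → p ∣ℕ q C k) (*-identityʳ p) (p∣p^C 1 0<k (subst (k <_) (sym (*-identityʳ p)) k<p))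

  X-1 : ℤ[X]
  X-1 = X ⊕ ⟨ -1ℤ ⟩

  J-X-1^-α≡0 : ∀ n → Coefficients.J p pr 0 (λ _ → n + L n) (X-1 ^ᴿ n)
  J-X-1^-α≡0 n = J-additive _ .≋-resp
    (R.trans (R.*-identityʳ _) (^-congˡ n (R.+-congʳ (R.*-identityʳ X))))
    (J-mono (λ _ → m≤m+n (n + L n) 0) (J-z^ {λ _ → 0} {⟨ 1ℤ ⟩} n (mkJ λ r l → p⁰∣ _)))
    where open Coefficients p pr 0

  module Positive (β : ℕ) where
    open Coefficients p pr (suc β)

    Q = p ^ β

    -- `I⁺` asks for one more p than `I` exactly where `t₀` vanishes, that is, at multiples of Q.
    I I⁺ : ℕ → ℤ[X] → Set
    I  e = J (λ r → e + t₀ β r)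
    I⁺ e = J (λ r → e + (1 ⊔ t₀ β r))

    I⁺⇒I : ∀ {e a} → I⁺ e a → I e a
    I⁺⇒I {e} {a} = J-mono {A = a} λ r → +-monoʳ-≤ e (m≤n⊔m 1 (t₀ β r))

    -- If Q divides r, then `t₀ β r` is 0 and nothing is claimed; otherwise 0 is not congruent to r
    -- and the pairing is 0.
    I-1 : I 0 ⟨ 1ℤ ⟩
    I-1 .divisible r l with pow β ∣? (0ℤ - r)
    ... | yes d = subst (λ e → pow e ℤ∣.∣ pow l ℤ.* ⟪ ⟨ 1ℤ ⟩ , r , falling l ⟫) (sym t₀r≡0) (p⁰∣ _)
      where
      t₀r≡0 : t₀ β r ≡ 0
      t₀r≡0 = t₀-multiple β (subst (pow β ℤ∣.∣_) (neg r) (ℤ∣.∣m⇒∣-m d))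
        where
        neg : ∀ r → ℤ.- (0ℤ - r) ≡ r
        neg = ℤ-Solver.solve-∀
    ... | no ¬d = ℤ∣.∣-trans (ℤ∣.divides 0ℤ refl) (ℤ∣.∣-reflexive (sym (trans (cong (pow l ℤ.*_)
          (cong (1ℤ ℤ.*_) (onMultiples-no (falling l) (λ d → ¬d (∣-pred β d))))) (ℤ.*-zeroʳ (pow l)))))

    I-scale : ∀ {s e n a} → p ^ s ∣ℕ n → I e a → I (s + e) (⟨ + n ⟩ ⊗ a)
    I-scale {s} {e} {a = a} d = J-scale s {A = a} d λ r → ≤-reflexive (+-assoc s e (t₀ β r))

    I-mono : ∀ {e e′ a} → e′ ≤ e → I e a → I e′ a
    I-mono {a = a} e′≤e = J-mono {A = a} λ r → +-monoˡ-≤ (t₀ β r) e′≤e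

    open DividedPowers p pr I (λ e → J-additive (λ r → e + t₀ β r)) I-scale I-mono

    stable-⟨⟩ : ∀ c → Stable ⟨ c ⟩
    stable-⟨⟩ c {e} {a} = J-⟨⟩ {λ r → e + t₀ β r} {a} c

    t₀-shift : ∀ r s → t₀ β r ≤ t₀ β (r - s) ⊔ t₀ β s
    t₀-shift r s = subst (λ x → t₀ β x ≤ t₀ β (r - s) ⊔ t₀ β s) (cancel r s) (t₀-ultrametric β (r - s) s)
      where
      cancel : ∀ r s → r - s ℤ.+ s ≡ r
      cancel = ℤ-Solver.solve-∀

    stable-X^Q : Stable (X ^ᴿ Q)
    stable-X^Q {e} {a} = J-shift Q {A = a} λ r → +-monoʳ-≤ e (begin
      t₀ β r                        ≤⟨ t₀-shift r (+ Q) ⟩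
      t₀ β (r - + Q) ⊔ t₀ β (+ Q)   ≡⟨ cong (t₀ β (r - + Q) ⊔_) (t₀-multiple β ℤ∣.∣-refl) ⟩
      t₀ β (r - + Q) ⊔ 0            ≡⟨ ⊔-identityʳ _ ⟩
      t₀ β (r - + Q)                ∎)
      where open ≤-Reasoning

    v : ℤ[X]
    v = X ^ᴿ Q ⊕ ⟨ -1ℤ ⟩

    stable-v : Stable v
    stable-v = stable-additive .⊕-closed stable-X^Q (stable-⟨⟩ -1ℤ)

    stable-⊗ : ∀ {b c} → Stable b → Stable c → Stable (b ⊗ c)
    stable-⊗ {b} {c} st st′ {e} {a} Ia = J-additive _ .≋-resp (R.sym (R.*-assoc b c a)) (st (st′ Ia))

    -- The form of the middle terms of (v + 1)^p: a coefficient divisible by p and at least one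
    -- factor v. The cofactor is kept stable so that `DP-root` applies.
    PV : ℤ[X] → Set
    PV b = ∃[ u ] Stable u × b ≋ ⟨ + p ⟩ ⊗ (v ⊗ u)

    PV-additive : Additive PV
    PV-additive .≋-resp e (u , st , eq) = u , (λ {e} → st {e}) , R.trans (R.sym e) eq
    PV-additive .0-closed = ⟨ 0ℤ ⟩ , (λ {e} → stable-⟨⟩ 0ℤ {e}) ,
      R.sym (R.trans (R.*-congˡ {⟨ + p ⟩} (R.zeroʳ v)) (R.zeroʳ ⟨ + p ⟩))
    PV-additive .⊕-closed (u , st , eq) (u′ , st′ , eq′) =
      u ⊕ u′ , (λ {e} → stable-additive .⊕-closed (λ {e} → st {e}) st′ {e}) , R.trans (R.+-cong eq eq′)
        (R.sym (R.trans (R.*-congˡ (R.distribˡ v u u′)) (R.distribˡ ⟨ + p ⟩ _ _)))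

    dp-v : ∀ m → DP 0 v m
    dp-v = DP-root {z} {v} {⟨ -1ℤ ⟩ ⊗ u} v^p≋ dp-z stable-v
      (λ {e} {a} Ia → J-additive _ .≋-resp (R.sym (R.*-assoc _ _ a)) (stable-⟨⟩ -1ℤ {e} (stable-u Ia)))
      where
      dp-z : ∀ m → DP 1 z m
      dp-z m {e} {a} Ia = J-mono {A = z ^ᴿ m ⊗ a} (λ r → ≤-reflexive (exponent m (L m) e (t₀ β r))) (J-z^ {A = a} m Ia)
        where
        exponent : ∀ m l e t → 1 * m + l + e + t ≡ m + l + (e + t)
        exponent = solve-∀
      terms : ∀ k → 0 < k → k < p → PV (Binomial.term PV-additive p v ⟨ 1ℤ ⟩ k)
      terms (suc k) 0<k k<p = term (p∣C 0<k k<p)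
        where
        term : p ∣ℕ p C suc k → PV (Binomial.term PV-additive p v ⟨ 1ℤ ⟩ (suc k))
        term (divides c eq) = ⟨ + c ⟩ ⊗ (v ^ᴿ k ⊗ ⟨ 1ℤ ⟩ ^ᴿ (p ∸ suc k)) ,
            (λ {e} Ia → stable-⊗ {⟨ + c ⟩} (stable-⟨⟩ (+ c))
              (stable-⊗ {v ^ᴿ k} (stable-^ stable-v k) (stable-^ (stable-⟨⟩ 1ℤ) (p ∸ suc k))) {e} Ia) ,
            mk≋ λ g j → begin
              + (p C suc k) ℤ.* act v (h g) j      ≡⟨ cong (λ n → + n ℤ.* act v (h g) j) eq ⟩
              + (c * p) ℤ.* act v (h g) j          ≡⟨ cong (ℤ._* act v (h g) j) (ℤ.pos-* c p) ⟩
              + c ℤ.* + p ℤ.* act v (h g) j        ≡⟨ swap (+ c) (+ p) (act v (h g) j) ⟩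
              + p ℤ.* (+ c ℤ.* act v (h g) j)      ≡⟨ cong (+ p ℤ.*_) (act-* v (+ c) (h g) j) ⟨
              + p ℤ.* act v (λ i → + c ℤ.* h g i) j  ∎
          where
          open ≡-Reasoning
          h : (ℤ → ℤ) → ℤ → ℤ
          h = act (v ^ᴿ k ⊗ ⟨ 1ℤ ⟩ ^ᴿ (p ∸ suc k))
          swap : ∀ a b x → a ℤ.* b ℤ.* x ≡ b ℤ.* (a ℤ.* x)
          swap = ℤ-Solver.solve-∀
      mid = binomial-middle PV-additive p v ⟨ 1ℤ ⟩ terms
      m = proj₁ mid
      u = proj₁ (proj₁ (proj₂ mid))
      stable-u : Stable u
      stable-u = proj₁ (proj₂ (proj₁ (proj₂ mid)))
      m≋ : m ≋ ⟨ + p ⟩ ⊗ (v ⊗ u)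
      m≋ = proj₂ (proj₂ (proj₁ (proj₂ mid)))
      v^p≋ : v ^ᴿ p ≋ z ⊕ ⟨ + p ⟩ ⊗ (v ⊗ (⟨ -1ℤ ⟩ ⊗ u))
      v^p≋ = begin
        -- Adding and subtracting 1 + m exhibits (v + 1)^p = X^(pQ); subtracting 1 leaves `z`, and
        -- -m is the remaining summand.
        v ^ᴿ p                                          ≈⟨ mk≋ (λ g k → rearrange₁ (act (v ^ᴿ p) g k) (act m g k) (g k)) ⟩
        ((⟨ 1ℤ ⟩ ⊕ m) ⊕ v ^ᴿ p) ⊕ ⟨ -1ℤ ⟩ ⊕ ⟨ -1ℤ ⟩ ⊗ m     ≈⟨ R.+-cong (R.+-congʳ {⟨ -1ℤ ⟩} [v+1]^p) ⟨-1⟩⊗m ⟩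
        z ⊕ ⟨ + p ⟩ ⊗ (v ⊗ (⟨ -1ℤ ⟩ ⊗ u))                  ∎
        where
        open ≋
        rearrange₁ : ∀ V M x → V ≡ ((1ℤ ℤ.* x ℤ.+ M) ℤ.+ V) ℤ.+ -1ℤ ℤ.* x ℤ.+ -1ℤ ℤ.* M
        rearrange₁ = ℤ-Solver.solve-∀
        rearrange₂ : ∀ y x → y ≡ y ℤ.+ -1ℤ ℤ.* x ℤ.+ 1ℤ ℤ.* x
        rearrange₂ = ℤ-Solver.solve-∀
        swap : ∀ a x → -1ℤ ℤ.* (a ℤ.* x) ≡ a ℤ.* (-1ℤ ℤ.* x)
        swap = ℤ-Solver.solve-∀
        [v+1]^p : (⟨ 1ℤ ⟩ ⊕ m) ⊕ v ^ᴿ p ≋ X ^ᴿ (p ^ suc β)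
        [v+1]^p = begin
          (⟨ 1ℤ ⟩ ⊕ m) ⊕ v ^ᴿ p       ≈⟨ R.+-congʳ (R.+-congʳ {m} (R.trans (⟨⟩-^ 1ℤ p) (R.reflexive (cong ⟨_⟩ (ℤ.^-zeroˡ p))))) ⟨
          (⟨ 1ℤ ⟩ ^ᴿ p ⊕ m) ⊕ v ^ᴿ p  ≈⟨ proj₂ (proj₂ mid) ⟨
          (v ⊕ ⟨ 1ℤ ⟩) ^ᴿ p           ≈⟨ ^-congˡ p (mk≋ λ g k → rearrange₂ (act (X ^ᴿ Q) g k) (g k)) ⟨
          (X ^ᴿ Q) ^ᴿ p               ≈⟨ ^-assocʳ X Q p ⟩
          X ^ᴿ (Q * p)                ≡⟨ cong (X ^ᴿ_) (*-comm Q p) ⟩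
          X ^ᴿ (p ^ suc β)            ∎
        ⟨-1⟩⊗m : ⟨ -1ℤ ⟩ ⊗ m ≋ ⟨ + p ⟩ ⊗ (v ⊗ (⟨ -1ℤ ⟩ ⊗ u))
        ⟨-1⟩⊗m = R.trans (R.*-congˡ {⟨ -1ℤ ⟩} m≋) (mk≋ λ g k →
          trans (swap (+ p) (act v (act u g) k)) (cong (+ p ℤ.*_) (sym (act-* v -1ℤ (act u g) k))))

    record Step (b : ℤ[X]) : Set where
      constructor mkStep
      field
        into : ∀ {e a} → I e a → I⁺ e (b ⊗ a)
        up   : ∀ {e a} → I⁺ e a → I⁺ (suc e) (b ⊗ a)
    open Step

    step-additive : Additive Step
    step-additive .≋-resp b≋c (mkStep i u) = mkStep
      (λ {e} {a} Ia → additive-⊗ a (J-additive _) .≋-resp b≋c (i Ia))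
      (λ {e} {a} Ia → additive-⊗ a (J-additive _) .≋-resp b≋c (u Ia))
    step-additive .0-closed = mkStep
      (λ {e} {a} _ → additive-⊗ a (J-additive _) .0-closed)
      (λ {e} {a} _ → additive-⊗ a (J-additive _) .0-closed)
    step-additive .⊕-closed (mkStep i u) (mkStep i′ u′) = mkStep
      (λ {e} {a} Ia → additive-⊗ a (J-additive _) .⊕-closed (i Ia) (i′ Ia))
      (λ {e} {a} Ia → additive-⊗ a (J-additive _) .⊕-closed (u Ia) (u′ Ia))

    J-monomial : ∀ {T T′ a} d {c} s ε → p ^ d ∣ℕ c → (∀ r → T′ r ≤ d + T (r - + s)) →
      J T a → J T′ ((⟨ + c ⟩ ⊗ (X ^ᴿ s ⊗ ⟨ ε ⟩)) ⊗ a)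
    J-monomial {T} {T′} {a} d {c} s ε d∣c T′≤ Ja = J-additive T′ .≋-resp (mk≋ λ g k → refl)
      (J-scale d {A = X ^ᴿ s ⊗ (⟨ ε ⟩ ⊗ a)} d∣c T′≤ (J-shift s (λ r → ≤-refl) (J-⟨⟩ ε Ja)))

    -- By the ultrametric inequality, the exponent wanted at r is at most the larger of d and the
    -- one available at r - s, while the coefficient adds d to the latter.
    step-monomial : ∀ d {c} s ε → p ^ d ∣ℕ c → 1 ≤ d → t₀ β (+ s) ≤ d → Step (⟨ + c ⟩ ⊗ (X ^ᴿ s ⊗ ⟨ ε ⟩))
    step-monomial d s ε d∣c 1≤d t₀s≤d = mkStep
      (λ {e} Ia → J-monomial d s ε d∣c (λ r → weaken e (≤-⊔⇒≤-+ 1≤d (t₀≤ r))) Ia)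
      (λ {e} Ia → J-monomial d s ε d∣c (λ r → weaken-suc e (≤-⊔⇒<-+ 1≤d (t₀≤ r))) Ia)
      where
      t₀≤ : ∀ r → t₀ β r ≤ t₀ β (r - + s) ⊔ d
      t₀≤ r = ≤-trans (t₀-shift r (+ s)) (⊔-monoʳ-≤ (t₀ β (r - + s)) t₀s≤d)
      swap : ∀ a b c → a + (b + c) ≡ b + (a + c)
      swap = solve-∀
      weaken : ∀ e {x y} → x ≤ d + y → e + x ≤ d + (e + y)
      weaken e {x} {y} x≤ = ≤-trans (+-monoʳ-≤ e x≤) (≤-reflexive (swap e d y))
      weaken-suc : ∀ e {x y} → x < d + y → suc e + x ≤ d + (e + y)
      weaken-suc e {x} {y} x< = ≤-trans (≤-reflexive (sym (+-suc e x))) (weaken e x<)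

    [X-1]^Q-split : ∃[ w ] Step w × X-1 ^ᴿ Q ≋ v ⊕ w
    -- Of the extreme terms X^Q and (-1)^Q, v takes X^Q - 1, so w consists of the middle terms and
    -- the constant (-1)^Q + 1.
    [X-1]^Q-split = m ⊕ ⟨ + c ⟩ , step-additive .⊕-closed step-m step-c , R.trans (proj₂ (proj₂ mid)) (R.trans
        (R.+-congʳ (R.+-congʳ (⟨⟩-^ -1ℤ Q)))
        (mk≋ λ g k → trans (rearrange (act (X ^ᴿ Q) g k) (act m g k) (-1ℤ ℤ.^ Q) (g k))
          (cong (λ y → act (X ^ᴿ Q) g k ℤ.+ -1ℤ ℤ.* g k ℤ.+ (act m g k ℤ.+ y ℤ.* g k)) (proj₂ (proj₂ (p∣-1^p^β+1 β))))))
      where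
      instance _ = m^n≢0 p β
      terms : ∀ k → 0 < k → k < Q → Step (Binomial.term step-additive Q X ⟨ -1ℤ ⟩ k)
      terms k 0<k k<Q = step-additive .≋-resp (R.*-congˡ {⟨ + (Q C k) ⟩} (R.*-congˡ {X ^ᴿ k} (R.sym (⟨⟩-^ -1ℤ (Q ∸ k)))))
        (step-monomial (t₀ β (+ k)) k (-1ℤ ℤ.^ (Q ∸ k)) (p^t₀∣C β ∣-refl (<⇒≤ k<Q)) (t₀>0 β 0<k k<Q) ≤-refl)
      mid = binomial-middle step-additive Q X ⟨ -1ℤ ⟩ terms
      m = proj₁ mid
      step-m : Step m
      step-m = proj₁ (proj₂ mid)
      c = proj₁ (p∣-1^p^β+1 β)
      step-c : Step ⟨ + c ⟩
      step-c = step-additive .≋-resp (R.trans (R.*-congˡ {⟨ + c ⟩} (R.*-identityʳ ⟨ 1ℤ ⟩)) (R.*-identityʳ ⟨ + c ⟩))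
        (step-monomial 1 0 1ℤ (subst (_∣ℕ c) (sym (*-identityʳ p)) (proj₁ (proj₂ (p∣-1^p^β+1 β)))) ≤-refl
          (≤-trans (≤-reflexive (t₀-multiple β (ℤ∣.divides 0ℤ refl))) z≤n))
      rearrange : ∀ Y M ε x → (ε ℤ.* x ℤ.+ M) ℤ.+ Y ≡ Y ℤ.+ -1ℤ ℤ.* x ℤ.+ (M ℤ.+ (ε ℤ.+ 1ℤ) ℤ.* x)
      rearrange = ℤ-Solver.solve-∀

    dp-step : ∀ {w} → Step w → ∀ m → DP 0 w m
    dp-step {w} step-w = DP-tail {w} I⁺ (λ {e} {a} {b} → J-additive (λ r → e + (1 ⊔ t₀ β r)) .≋-resp {a} {b})
      (λ {e} {a} → step-w .into {e} {a}) (λ {e} {a} → step-w .up {e} {a}) (λ {e} {a} → I⁺⇒I {e} {a})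

    dp-v+w : ∀ {w} → Step w → ∀ m → DP 0 (v ⊕ w) m
    dp-v+w {w} step-w m = DP-+ {0} {v} {w} m (λ k _ → dp-v k) (λ k _ → dp-step step-w k)

    dp-[X-1]^Q : ∀ m → DP 0 (X-1 ^ᴿ Q) m
    dp-[X-1]^Q m = let w , step-w , eq = [X-1]^Q-split in
      DP-resp 0 m {v ⊕ w} {X-1 ^ᴿ Q} (R.sym eq) (dp-v+w {w} step-w m)

    -- Write n = n₀ + Qm. The factor (X - 1)^(Qm) provides `L m` and `t₀`; in the expansion of (X -
    -- 1)^n₀, the coefficient of X^k provides `t β n₀ k`, and `t-subadditive` joins the two counts.
    J-X-1^ : ∀ n → J (λ r → L ⌊ n /p^ β ⌋ + t β n r) (X-1 ^ᴿ n)
    J-X-1^ n = J-additive _ .≋-resp eq (Binomial.all-terms (additive-⊗ a (J-additive _)) n₀ X ⟨ -1ℤ ⟩ λ k k≤n₀ →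
        additive-⊗ a (J-additive _) .≋-resp (R.*-congˡ {⟨ + (n₀ C k) ⟩} (R.*-congˡ {X ^ᴿ k} (R.sym (⟨⟩-^ -1ℤ (n₀ ∸ k)))))
          (J-monomial (t β n₀ (+ k)) k (-1ℤ ℤ.^ (n₀ ∸ k)) (p^t∣C β k≤n₀) (λ r → begin
            L m + t β n r                              ≤⟨ +-monoʳ-≤ (L m) (t-n₀ r) ⟩
            L m + t β n₀ r                             ≤⟨ +-monoʳ-≤ (L m) (t-subadditive β n₀ k r) ⟩
            L m + (t β n₀ (+ k) + t₀ β (r - + k))      ≡⟨ swap (L m) (t β n₀ (+ k)) _ ⟩
            t β n₀ (+ k) + (L m + t₀ β (r - + k))      ∎)
            Ia))
      where
      open ≤-Reasoning
      m = ⌊ n /p^ β ⌋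
      n₀ = (+ n) %p^ β
      a = (X-1 ^ᴿ Q) ^ᴿ m ⊗ ⟨ 1ℤ ⟩
      Ia : J (λ r → L m + t₀ β r) a
      Ia = J-mono (λ r → ≤-reflexive (cong (_+ t₀ β r) (sym (+-identityʳ (L m))))) (dp-[X-1]^Q m I-1)
      swap : ∀ a b c → a + (b + c) ≡ b + (a + c)
      swap = solve-∀
      t-n₀ : ∀ r → t β n r ≤ t β n₀ r
      -- The moduli p, ..., p^β divide Q, so n and n₀ have the same residues.
      t-n₀ r = Σ<-mono β λ i i<β → indicator-mono ((+ n) %p^ suc i <? r %p^ suc i) ((+ n₀) %p^ suc i <? r %p^ suc i)
        (subst (_< r %p^ suc i) (sym (m∣n⇒o%n%m≡o%m (p ^ suc i) (p ^ β) n {{m^n≢0 p (suc i)}} {{m^n≢0 p β}} (p^-mono-∣ i<β))))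
      eq : X-1 ^ᴿ n₀ ⊗ a ≋ X-1 ^ᴿ n
      eq = R.trans (R.*-congˡ (R.trans (R.*-identityʳ _) (^-assocʳ X-1 Q m)))
        (R.trans (R.sym (^-homo-* X-1 n₀ (Q * m))) (^-congʳ X-1 (trans (cong (λ y → n₀ + y) (*-comm Q m))
          (sym (m≡m%n+[m/n]*n n Q {{m^n≢0 p β}})))))

-- From falling factorials to the polynomial f

evalℤ : List ℤ → ℤ → ℤ
evalℤ []      x = 0ℤ
evalℤ (a ∷ f) x = a ℤ.+ x ℤ.* evalℤ f x

coeffℤ : List ℤ → ℕ → ℤ
coeffℤ []      _       = 0ℤ
coeffℤ (a ∷ f) zero    = a
coeffℤ (a ∷ f) (suc i) = coeffℤ f i

evalℤ-factor : ∀ m f → (∀ i → m ℤ∣.∣ coeffℤ f i) → ∃[ g ] (∀ x → evalℤ f x ≡ m ℤ.* evalℤ g x)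
evalℤ-factor m []      m∣f = [] , λ x → sym (ℤ.*-zeroʳ m)
evalℤ-factor m (a ∷ f) m∣f with m∣f 0 | evalℤ-factor m f (m∣f ∘ suc)
... | ℤ∣.divides b refl | g , eq = b ∷ g , λ x → trans (cong (λ y → b ℤ.* m ℤ.+ x ℤ.* y) (eq x)) (rearrange b m x (evalℤ g x))
  where
  rearrange : ∀ b m x y → b ℤ.* m ℤ.+ x ℤ.* (m ℤ.* y) ≡ m ℤ.* (b ℤ.+ x ℤ.* y)
  rearrange = ℤ-Solver.solve-∀

module Weights (p : ℕ) (pr : Prime p) (α : ℕ) where
  open Valuation p pr
  open Padic p {{prime⇒nonZero pr}}
  open Coefficients p pr α

  ⟪⟫-factor : ∀ A r m f → (∀ i → m ℤ∣.∣ coeffℤ f i) → m ℤ∣.∣ ⟪ A , r , evalℤ f ⟫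
  ⟪⟫-factor A r m f m∣f = let g , eq = evalℤ-factor m f m∣f in
    subst (m ℤ∣.∣_) (sym (trans (⟪⟫-cong A r eq) (⟪⟫-* A r m (evalℤ g)))) (ℤ∣.∣m⇒∣m*n _ ℤ∣.∣-refl)

  infixl 7 _·_
  _·_ : (ℤ → ℤ) → (ℤ → ℤ) → ℤ → ℤ
  (g · h) x = g x ℤ.* h x

  module _ {T A} (JA : J T A) (r : ℤ) where

    -- By x · `falling l` = `falling (l + 1)` + l · `falling l`, the factors x are absorbed one by
    -- one, with d + l bounding the degree. The integer coefficients represent residues, so those
    -- beyond d are only multiples of p^(T r), not 0.
    J-poly-falling : ∀ f d l → (∀ i → d < i → pow (T r) ℤ∣.∣ coeffℤ f i) →
      pow (T r) ℤ∣.∣ pow (d + l) ℤ.* ⟪ A , r , evalℤ f · falling l ⟫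
    J-poly-falling [] d l _ = subst (pow (T r) ℤ∣.∣_)
      (sym (trans (cong (pow (d + l) ℤ.*_) (⟪⟫-* A r 0ℤ (falling l))) (ℤ.*-zeroʳ (pow (d + l))))) (ℤ∣.divides 0ℤ refl)
    J-poly-falling (a ∷ f) zero l high = let g , eq = evalℤ-factor (pow (T r)) f (λ i → high (suc i) z<s) in
      subst (pow (T r) ℤ∣.∣_) (sym (split g eq))
        (ℤ∣.∣m∣n⇒∣m+n (ℤ∣.∣n⇒∣m*n a (JA .divisible r l)) (ℤ∣.∣n⇒∣m*n (pow l) (ℤ∣.∣m⇒∣m*n _ ℤ∣.∣-refl)))
      where
      module _ (g : List ℤ) (eq : ∀ x → evalℤ f x ≡ pow (T r) ℤ.* evalℤ g x) where
        h : ℤ → ℤ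
        h x = x ℤ.* evalℤ g x ℤ.* falling l x
        distribute : ∀ a x m y w → (a ℤ.+ x ℤ.* (m ℤ.* y)) ℤ.* w ≡ a ℤ.* w ℤ.+ m ℤ.* (x ℤ.* y ℤ.* w)
        distribute = ℤ-Solver.solve-∀
        collect : ∀ P a F m H → P ℤ.* (a ℤ.* F ℤ.+ m ℤ.* H) ≡ a ℤ.* (P ℤ.* F) ℤ.+ P ℤ.* (m ℤ.* H)
        collect = ℤ-Solver.solve-∀
        open ≡-Reasoning
        split : pow l ℤ.* ⟪ A , r , evalℤ (a ∷ f) · falling l ⟫
          ≡ a ℤ.* (pow l ℤ.* ⟪ A , r , falling l ⟫) ℤ.+ pow l ℤ.* (pow (T r) ℤ.* ⟪ A , r , h ⟫)
        split = begin
          pow l ℤ.* ⟪ A , r , evalℤ (a ∷ f) · falling l ⟫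
            ≡⟨ cong (pow l ℤ.*_) (⟪⟫-cong A r λ x → trans (cong (λ y → (a ℤ.+ x ℤ.* y) ℤ.* falling l x) (eq x))
                 (distribute a x (pow (T r)) (evalℤ g x) (falling l x))) ⟩
          pow l ℤ.* ⟪ A , r , (λ x → a ℤ.* falling l x ℤ.+ pow (T r) ℤ.* h x) ⟫
            ≡⟨ cong (pow l ℤ.*_) (trans (⟪⟫-+ A r (λ x → a ℤ.* falling l x) (λ x → pow (T r) ℤ.* h x))
                 (cong₂ ℤ._+_ (⟪⟫-* A r a (falling l)) (⟪⟫-* A r (pow (T r)) h))) ⟩
          pow l ℤ.* (a ℤ.* ⟪ A , r , falling l ⟫ ℤ.+ pow (T r) ℤ.* ⟪ A , r , h ⟫)
            ≡⟨ collect (pow l) a _ (pow (T r)) _ ⟩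
          a ℤ.* (pow l ℤ.* ⟪ A , r , falling l ⟫) ℤ.+ pow l ℤ.* (pow (T r) ℤ.* ⟪ A , r , h ⟫) ∎
    J-poly-falling (a ∷ f) (suc d) l high = subst (pow (T r) ℤ∣.∣_) (sym split)
      (ℤ∣.∣m∣n⇒∣m+n (ℤ∣.∣n⇒∣m*n (a ℤ.* pow (suc d)) (JA .divisible r l))
        (ℤ∣.∣m∣n⇒∣m+n (subst (λ e → pow (T r) ℤ∣.∣ pow e ℤ.* ⟪ A , r , evalℤ f · falling (suc l) ⟫) (+-suc d l)
            (J-poly-falling f d (suc l) (λ i → high (suc i) ∘ s<s)))
          (ℤ∣.∣n⇒∣m*n (+ p ℤ.* + l) (J-poly-falling f d l (λ i → high (suc i) ∘ s<s)))))
      where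
      F₀ = evalℤ f · falling l
      F₁ = evalℤ f · falling (suc l)
      distribute : ∀ a x y w l → (a ℤ.+ x ℤ.* y) ℤ.* w ≡ a ℤ.* w ℤ.+ (y ℤ.* (w ℤ.* (x - l)) ℤ.+ l ℤ.* (y ℤ.* w))
      distribute = ℤ-Solver.solve-∀
      collect : ∀ P p P₁ l a x y w → P₁ ≡ p ℤ.* P →
        P₁ ℤ.* (a ℤ.* x ℤ.+ (y ℤ.+ l ℤ.* w)) ≡ a ℤ.* (P₁ ℤ.* x) ℤ.+ (P₁ ℤ.* y ℤ.+ p ℤ.* l ℤ.* (P ℤ.* w))
      collect P p _ l a x y w refl = go P p l a x y w
        where
        go : ∀ P p l a x y w →
          p ℤ.* P ℤ.* (a ℤ.* x ℤ.+ (y ℤ.+ l ℤ.* w)) ≡ a ℤ.* (p ℤ.* P ℤ.* x) ℤ.+ (p ℤ.* P ℤ.* y ℤ.+ p ℤ.* l ℤ.* (P ℤ.* w))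
        go = ℤ-Solver.solve-∀
      assoc : ∀ a D P x → a ℤ.* (D ℤ.* P ℤ.* x) ≡ a ℤ.* D ℤ.* (P ℤ.* x)
      assoc = ℤ-Solver.solve-∀
      open ≡-Reasoning
      split : pow (suc d + l) ℤ.* ⟪ A , r , evalℤ (a ∷ f) · falling l ⟫
        ≡ a ℤ.* pow (suc d) ℤ.* (pow l ℤ.* ⟪ A , r , falling l ⟫) ℤ.+
          (pow (suc d + l) ℤ.* ⟪ A , r , F₁ ⟫ ℤ.+ + p ℤ.* + l ℤ.* (pow (d + l) ℤ.* ⟪ A , r , F₀ ⟫))
      split = begin
        pow (suc d + l) ℤ.* ⟪ A , r , evalℤ (a ∷ f) · falling l ⟫
          ≡⟨ cong (pow (suc d + l) ℤ.*_) (⟪⟫-cong A r λ x → distribute a x (evalℤ f x) (falling l x) (+ l)) ⟩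
        pow (suc d + l) ℤ.* ⟪ A , r , (λ x → a ℤ.* falling l x ℤ.+ (F₁ x ℤ.+ + l ℤ.* F₀ x)) ⟫
          ≡⟨ cong (pow (suc d + l) ℤ.*_) (trans (⟪⟫-+ A r (λ x → a ℤ.* falling l x) (λ x → F₁ x ℤ.+ + l ℤ.* F₀ x))
               (cong₂ ℤ._+_ (⟪⟫-* A r a (falling l)) (trans (⟪⟫-+ A r F₁ (λ x → + l ℤ.* F₀ x))
                 (cong (λ y → ⟪ A , r , F₁ ⟫ ℤ.+ y) (⟪⟫-* A r (+ l) F₀))))) ⟩
        pow (suc d + l) ℤ.* (a ℤ.* ⟪ A , r , falling l ⟫ ℤ.+ (⟪ A , r , F₁ ⟫ ℤ.+ + l ℤ.* ⟪ A , r , F₀ ⟫))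
          ≡⟨ collect (pow (d + l)) (+ p) (pow (suc d + l)) (+ l) a _ _ _ (ℤ.pos-* p (p ^ (d + l))) ⟩
        a ℤ.* (pow (suc d + l) ℤ.* ⟪ A , r , falling l ⟫) ℤ.+
          (pow (suc d + l) ℤ.* ⟪ A , r , F₁ ⟫ ℤ.+ + p ℤ.* + l ℤ.* (pow (d + l) ℤ.* ⟪ A , r , F₀ ⟫))
          ≡⟨ cong (ℤ._+ (pow (suc d + l) ℤ.* ⟪ A , r , F₁ ⟫ ℤ.+ + p ℤ.* + l ℤ.* (pow (d + l) ℤ.* ⟪ A , r , F₀ ⟫)))
               (trans (cong (λ y → a ℤ.* (y ℤ.* ⟪ A , r , falling l ⟫)) (pow-+ (suc d) l)) (assoc a (pow (suc d)) (pow l) _)) ⟩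
        _ ∎

    J-poly : ∀ f d → (∀ i → d < i → pow (T r) ℤ∣.∣ coeffℤ f i) → pow (T r) ℤ∣.∣ pow d ℤ.* ⟪ A , r , evalℤ f ⟫
    J-poly f d high = subst₂ (λ e y → pow (T r) ℤ∣.∣ pow e ℤ.* y) (+-identityʳ d)
      (⟪⟫-cong A r λ x → ℤ.*-identityʳ (evalℤ f x)) (J-poly-falling f d 0 high)

  -- Written as (-X) + 1 so that the k-th binomial term carries the sign (-1)^k of `binomialTerm`,
  -- which lets `approx-binomialSum` match the two sums term by term.
  [1-X]^ : ℕ → ℤ[X]
  [1-X]^ n = (⟨ -1ℤ ⟩ ⊗ X ⊕ ⟨ 1ℤ ⟩) ^ᴿ n

  J-[1-X]^ : ∀ {T} n → J T ((X ⊕ ⟨ -1ℤ ⟩) ^ᴿ n) → J T ([1-X]^ n)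
  J-[1-X]^ n JA = J-additive _ .≋-resp (R.trans (R.*-congʳ (R.sym (⟨⟩-^ -1ℤ n)))
      (R.trans (R.sym (^-distrib-* ⟨ -1ℤ ⟩ (X ⊕ ⟨ -1ℤ ⟩) n)) (^-congˡ n (mk≋ λ g k → distribute (g (k ℤ.+ 1ℤ)) (g k)))))
    (J-⟨⟩ (-1ℤ ℤ.^ n) JA)
    where
    distribute : ∀ x y → -1ℤ ℤ.* (x ℤ.+ -1ℤ ℤ.* y) ≡ -1ℤ ℤ.* x ℤ.+ 1ℤ ℤ.* y
    distribute = ℤ-Solver.solve-∀

  approxPoly : Poly → ℕ → List ℤ
  approxPoly f i = map (λ a → approx a i) f

  approx-eval : ∀ f x i → approx (eval f (fromℤ x)) i ≡ evalℤ (approxPoly f i) x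
  approx-eval []      x i = refl
  approx-eval (a ∷ f) x i = cong (λ y → approx a i ℤ.+ x ℤ.* y) (approx-eval f x i)

  approx-coeff : ∀ f j i → approx (coeff f j) i ≡ coeffℤ (approxPoly f i) j
  approx-coeff []      j       i = refl
  approx-coeff (a ∷ f) zero    i = refl
  approx-coeff (a ∷ f) (suc j) i = approx-coeff f j i

  coeff≈0⇒∣ : ∀ f j i → coeff f j ≈ 0# → pow i ℤ∣.∣ coeffℤ (approxPoly f i) j
  coeff≈0⇒∣ f j i c≈0 = subst (pow i ℤ∣.∣_) (trans (ℤ.+-identityʳ _) (approx-coeff f j i)) (congruent c≈0 i)

  approx-binomialSum : ∀ f n r i → approx (binomialSum f α n r) i ≡ ⟪ [1-X]^ n , r , evalℤ (approxPoly f i) ⟫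
  approx-binomialSum f n r i = sym (trans (act-≡ (binomial-theorem n (⟨ -1ℤ ⟩ ⊗ X) ⟨ 1ℤ ⟩) g 0ℤ)
      (act-∑ (binomial-term (⟨ -1ℤ ⟩ ⊗ X) ⟨ 1ℤ ⟩ n) (λ k → binomialTerm f α n r (toℕ k)) term≡))
    where
    h = evalℤ (approxPoly f i)
    g : ℤ → ℤ
    g k = onMultiples h (k - r)
    act-∑ : ∀ {m} (F : Fin m → ℤ[X]) (G : Fin m → ℤₚ) → (∀ k → act (F k) g 0ℤ ≡ approx (G k) i) →
      act (∑ᴿ F) g 0ℤ ≡ approx (∑ G) i
    act-∑ {zero}  F G e = refl
    act-∑ {suc m} F G e = cong₂ ℤ._+_ (e fzero) (act-∑ (F ∘ fsuc) (G ∘ fsuc) (e ∘ fsuc))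
    if-approx : ∀ b c y {x : ℤₚ} → approx x i ≡ c ℤ.* y →
      approx (if b then x else fromℤ 0ℤ) i ≡ c ℤ.* (if b then y else 0ℤ)
    if-approx true  c y e = e
    if-approx false c y e = sym (ℤ.*-zeroʳ c)
    coef : ℕ → ℤ
    coef k = + (n C k) ℤ.* -1ℤ ℤ.^ k
    approx-term : ∀ k → approx (binomialTerm f α n r k) i ≡ coef k ℤ.* g (+ k)
    approx-term k = if-approx (does (pow α ∣? (+ k - r))) (coef k) (h ⌊ + k - r /p^ α ⌋ℤ)
      (cong (coef k ℤ.*_) (approx-eval f ⌊ + k - r /p^ α ⌋ℤ i))
    power : ∀ k → (⟨ -1ℤ ⟩ ⊗ X) ^ᴿ k ⊗ ⟨ 1ℤ ⟩ ^ᴿ (n ∸ k) ≋ ⟨ -1ℤ ℤ.^ k ⟩ ⊗ X ^ᴿ k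
    power k = R.trans (R.*-cong (R.trans (^-distrib-* ⟨ -1ℤ ⟩ X k) (R.*-congʳ (⟨⟩-^ -1ℤ k)))
      (R.trans (⟨⟩-^ 1ℤ (n ∸ k)) (R.reflexive (cong ⟨_⟩ (ℤ.^-zeroˡ (n ∸ k)))))) (R.*-identityʳ _)
    act-term : ∀ k → act (⟨ + (n C k) ⟩ ⊗ ((⟨ -1ℤ ⟩ ⊗ X) ^ᴿ k ⊗ ⟨ 1ℤ ⟩ ^ᴿ (n ∸ k))) g 0ℤ ≡ coef k ℤ.* g (+ k)
    act-term k = trans (cong (+ (n C k) ℤ.*_) (trans (act-≡ (power k) g 0ℤ) (cong (-1ℤ ℤ.^ k ℤ.*_) (act-X^ k g 0ℤ))))
      (sym (ℤ.*-assoc (+ (n C k)) (-1ℤ ℤ.^ k) (g (+ k))))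
    term≡ : ∀ (k : Fin (suc n)) → act (binomial-term (⟨ -1ℤ ⟩ ⊗ X) ⟨ 1ℤ ⟩ n k) g 0ℤ ≡ approx (binomialTerm f α n r (toℕ k)) i
    term≡ k = trans (act-≡ (×≋⟨⟩⊗ (n C toℕ k) _) g 0ℤ) (trans (act-term (toℕ k)) (sym (approx-term (toℕ k))))

-- Carries of the schoolbook addition

%ℕ-% : ∀ r P Q .{{_ : NonZero P}} .{{_ : NonZero Q}} → P ∣ℕ Q → (r ℤ.%ℕ Q) % P ≡ r ℤ.%ℕ P
%ℕ-% r P Q P∣Q = %ℕ-cong P (+ (r ℤ.%ℕ Q)) r (ℤ∣.∣-trans (ℤ∣.∣ᵤ⇒∣ P∣Q)
  (subst (+ Q ℤ∣.∣_) (negate r _) (ℤ∣.∣m⇒∣-m (∣r-r%ℕP Q r))))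
  where
  negate : ∀ a b → ℤ.- (a - b) ≡ b - a
  negate = ℤ-Solver.solve-∀

-- If the residues A of r and B of n - r reach P together, then n has residue A + B - P, which is
-- below A because B < P.
carry≤indicator : ∀ P n r .{{_ : NonZero P}} →
  (r ℤ.%ℕ P + (+ n - r) ℤ.%ℕ P) / P ≤ indicator (n % P <? r ℤ.%ℕ P)
carry≤indicator P n r with r ℤ.%ℕ P + (+ n - r) ℤ.%ℕ P <? P
... | yes <P = ≤-trans (≤-reflexive (m<n⇒m/n≡0 <P)) z≤n
... | no ≮P  = begin
  (A + B) / P                      ≡⟨ m/n≡1+[m∸n]/n (≮⇒≥ ≮P) ⟩
  suc ((A + B ∸ P) / P)            ≡⟨ cong suc (m<n⇒m/n≡0 (<-trans A+B∸P<A (ℤ.n%ℕd<d r P))) ⟩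
  1                                ≡⟨ if-yes (n % P <? A) n%P<A ⟨
  indicator (n % P <? A)           ∎
  where
  open ≤-Reasoning
  A = r ℤ.%ℕ P
  B = (+ n - r) ℤ.%ℕ P
  A+B∸P<A : A + B ∸ P < A
  A+B∸P<A = m<n+o⇒m∸n<o (A + B) P {{>-nonZero A>0}} (subst (A + B <_) (+-comm A P) (+-monoʳ-< A (ℤ.n%ℕd<d (+ n - r) P)))
    where
    A>0 : 0 < A
    A>0 = n≢0⇒n>0 λ A≡0 → ≮P (subst (λ x → x + B < P) (sym A≡0) (ℤ.n%ℕd<d (+ n - r) P))
  n%P<A : n % P < A
  n%P<A = subst (_< A) (trans (sym (m<n⇒m%n≡m (<-trans A+B∸P<A (ℤ.n%ℕd<d r P)))) (trans (m≤n⇒[n∸m]%m≡n%m (≮⇒≥ ≮P))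
    (%ℕ-cong P (+ (A + B)) (+ n) (subst (+ P ℤ∣.∣_) (trans (negate r (+ n) (+ A) (+ B)) (cong (_- + n) (sym (ℤ.pos-+ A B))))
      (ℤ∣.∣m⇒∣-m (ℤ∣.∣m∣n⇒∣m+n (∣r-r%ℕP P r) (∣r-r%ℕP P (+ n - r)))))))) A+B∸P<A
    where
    negate : ∀ r n a b → ℤ.- ((r - a) ℤ.+ ((n - r) - b)) ≡ (a ℤ.+ b) - n
    negate = ℤ-Solver.solve-∀

module Carries (p : ℕ) (pr : Prime p) where
  open Valuation p pr
  open Padic p {{prime⇒nonZero pr}}

  infixl 7 _mod^_
  _mod^_ : ℕ → ℕ → ℕ
  a mod^ i = (+ a) %p^ i

  mod^-suc : ∀ a i → a mod^ suc i ≡ a mod^ i + digit a i * p ^ i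
  mod^-suc a i = begin
    a mod^ suc i                                        ≡⟨ m≡m%n+[m/n]*n (a mod^ suc i) (p ^ i) ⟩
    a mod^ suc i % p ^ i + a mod^ suc i / p ^ i * p ^ i ≡⟨ cong₂ (λ x y → x + y * p ^ i)
      (m∣n⇒o%n%m≡o%m (p ^ i) (p ^ suc i) a (p^-mono-∣ (n≤1+n i))) (m%[n*o]/o≡m/o%n a p (p ^ i)) ⟩
    a mod^ i + digit a i * p ^ i                        ∎
    where
    open ≡-Reasoning
    instance
      _ = m^n≢0 p i
      _ = m^n≢0 p (suc i)

  -- The carry into position i is the overflow of the i lowest digits. In the induction, the new
  -- digits are moved inside the floor as a multiple of p^i, where nested floors merge.
  carry≡ : ∀ a b i → carry a b i ≡ ⌊ a mod^ i + b mod^ i /p^ i ⌋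
  carry≡ a b zero    = sym (cong₂ (λ x y → (x + y) / 1) (n%1≡0 a) (n%1≡0 b))
  carry≡ a b (suc i) = begin
    (digit a i + digit b i + carry a b i) / p         ≡⟨ cong (λ c → (digit a i + digit b i + c) / p) (carry≡ a b i) ⟩
    (digit a i + digit b i + ⌊ a mod^ i + b mod^ i /p^ i ⌋) / p
      ≡⟨ /-congˡ (trans (+-comm (digit a i + digit b i) _)
           (sym (trans (+-distrib-/-∣ʳ (a mod^ i + b mod^ i) (n∣m*n (digit a i + digit b i)))
           (cong (λ x → ⌊ a mod^ i + b mod^ i /p^ i ⌋ + x) (m*n/n≡m (digit a i + digit b i) (p ^ i)))))) ⟩
    ⌊ a mod^ i + b mod^ i + (digit a i + digit b i) * p ^ i /p^ i ⌋ / p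
      ≡⟨ m/n/o≡m/[n*o] _ (p ^ i) p ⟩
    (a mod^ i + b mod^ i + (digit a i + digit b i) * p ^ i) / (p ^ i * p)
      ≡⟨ /-congˡ (rearrange (a mod^ i) (b mod^ i) (digit a i) (digit b i) (p ^ i)) ⟩
    ((a mod^ i + digit a i * p ^ i) + (b mod^ i + digit b i * p ^ i)) / (p ^ i * p)
      ≡⟨ /-congʳ (*-comm (p ^ i) p) ⟩
    ((a mod^ i + digit a i * p ^ i) + (b mod^ i + digit b i * p ^ i)) / p ^ suc i
      ≡⟨ /-congˡ (cong₂ _+_ (mod^-suc a i) (mod^-suc b i)) ⟨
    (a mod^ suc i + b mod^ suc i) / p ^ suc i         ∎
    where
    open ≡-Reasoning
    instance
      _ = m^n≢0 p i
      _ = m^n≢0 p (suc i)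
      _ = m*n≢0 (p ^ i) p
    rearrange : ∀ a b c d q → a + b + (c + d) * q ≡ (a + c * q) + (b + d * q)
    rearrange = solve-∀

  carry-vanishes : ∀ β {a b} → a < p ^ β → b < p ^ β → ∀ i → β ≤ i → carry a b (suc i) ≡ 0
  carry-vanishes β {a} {b} a< b< i β≤i = trans (carry≡ a b (suc i)) (m<n⇒m/n≡0 (begin-strict
    a mod^ suc i + b mod^ suc i  ≤⟨ +-mono-≤ (m%n≤m a (p ^ suc i)) (m%n≤m b (p ^ suc i)) ⟩
    a + b                        <⟨ +-mono-< a< b< ⟩
    p ^ β + p ^ β                ≡⟨ cong (λ x → p ^ β + x) (+-identityʳ (p ^ β)) ⟨
    2 * p ^ β                    ≤⟨ *-mono-≤ 2≤p (^-monoʳ-≤ p β≤i) ⟩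
    p ^ suc i                    ∎))
    where
    open ≤-Reasoning
    instance _ = m^n≢0 p (suc i)

  -- Both summands are below p^β, so no carry leaves position β or a higher one; the lower positions
  -- are compared by `carry≤indicator`.
  τ≤t : ∀ β n r → τ (r %p^ β) ((+ n - r) %p^ β) ≤ t β n r
  τ≤t β n r = ≤-trans (Σ<-truncate β (a + b) (carry-vanishes β (ℤ.n%ℕd<d r (p ^ β)) (ℤ.n%ℕd<d (+ n - r) (p ^ β))))
    (Σ<-mono β bound)
    where
    instance _ = m^n≢0 p β
    a = r %p^ β
    b = (+ n - r) %p^ β
    bound : ∀ i → i < β → carry a b (suc i) ≤ indicator ((+ n) %p^ suc i <? r %p^ suc i)
    bound i i<β = ≤-trans (≤-reflexive (trans (carry≡ a b (suc i)) (cong₂ (λ x y → ⌊ x + y /p^ suc i ⌋)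
        (%ℕ-% r (p ^ suc i) (p ^ β) (p^-mono-∣ i<β)) (%ℕ-% (+ n - r) (p ^ suc i) (p ^ β) (p^-mono-∣ i<β)))))
      (carry≤indicator (p ^ suc i) n r)
      where instance _ = m^n≢0 p (suc i)

-- Divisibility by powers of p in ℤₚ, read off one component

module PadicDivisibility (p : ℕ) (pr : Prime p) where
  open Valuation p pr
  open Padic p {{prime⇒nonZero pr}}

  approx-coherent : ∀ ω i d → pow i ℤ∣.∣ approx ω (d + i) - approx ω i
  approx-coherent ω i zero    = subst (pow i ℤ∣.∣_) (sym (ℤ.+-inverseʳ (approx ω i))) (ℤ∣.divides 0ℤ refl)
  approx-coherent ω i (suc d) = subst (pow i ℤ∣.∣_) (telescope (approx ω (suc d + i)) _ _)
    (ℤ∣.∣m∣n⇒∣m+n (ℤ∣.∣-trans (pow-mono (m≤n+m i d)) (coherent ω (d + i))) (approx-coherent ω i d))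
    where
    telescope : ∀ a b c → (a - b) ℤ.+ (b - c) ≡ a - c
    telescope = ℤ-Solver.solve-∀

  ∣-difference : ∀ {m a b} → m ℤ∣.∣ a - b → m ℤ∣.∣ b → m ℤ∣.∣ a
  ∣-difference {m} {a} {b} d e = subst (m ℤ∣.∣_) (cancel a b) (ℤ∣.∣m∣n⇒∣m+n d e)
    where
    cancel : ∀ a b → a - b ℤ.+ b ≡ a
    cancel = ℤ-Solver.solve-∀

  ∣-difference′ : ∀ {m a b} → m ℤ∣.∣ a - b → m ℤ∣.∣ a → m ℤ∣.∣ b
  ∣-difference′ {m} {a} {b} d e = subst (m ℤ∣.∣_) (cancel a b) (ℤ∣.∣m∣n⇒∣m-n e d)
    where
    cancel : ∀ a b → a - (a - b) ≡ b
    cancel = ℤ-Solver.solve-∀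

  pᵉ∣⇒∣approx : ∀ c {ω} → pᵉ c ∣ ω → pow c ℤ∣.∣ approx ω c
  pᵉ∣⇒∣approx c (q , eq) = ∣-difference′ {a = approx q c ℤ.* pow c} (congruent eq c) (ℤ∣.∣n⇒∣m*n (approx q c) ℤ∣.∣-refl)

  -- Coherence modulo p^c carries the divisibility to every component i + c. Division by p^c loses c
  -- digits of precision, so component i of the quotient comes from component i + c of ω.
  ∣approx⇒pᵉ∣ : ∀ c d ω → pow c ℤ∣.∣ approx ω (d + c) → pᵉ c ∣ ω
  ∣approx⇒pᵉ∣ c d ω c∣ω = q , mk≈ λ i → subst (pow i ℤ∣.∣_) (cong (_- approx ω i) (ℤ∣._∣_.equality (c∣approx i)))
    (subst (λ e → pow i ℤ∣.∣ approx ω e - approx ω i) (+-comm c i) (approx-coherent ω i c))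
    where
    c∣approx : ∀ i → pow c ℤ∣.∣ approx ω (i + c)
    c∣approx i = ∣-difference (approx-coherent ω c i) (∣-difference′ (approx-coherent ω c d) c∣ω)
    q : ℤₚ
    q .approx i   = ℤ∣._∣_.quotient (c∣approx i)
    q .coherent i = ℤ∣.*-cancelʳ-∣ (pow c) {{m^n≢0 p c}} (subst₂ ℤ∣._∣_ (pow-+ i c)
      (trans (cong₂ _-_ (ℤ∣._∣_.equality (c∣approx (suc i))) (ℤ∣._∣_.equality (c∣approx i)))
        (sym (factor (ℤ∣._∣_.quotient (c∣approx (suc i))) (ℤ∣._∣_.quotient (c∣approx i)) (pow c))))
      (coherent ω (i + c)))
      where
      factor : ∀ x y m → (x - y) ℤ.* m ≡ x ℤ.* m - y ℤ.* m
      factor = ℤ-Solver.solve-∀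

  ∣approx*approx⇒pᵉ∣⊠ : ∀ k c x y → c ≤ k → pow k ℤ∣.∣ approx x k ℤ.* approx y k → pᵉ c ∣ (x ⊠ y)
  ∣approx*approx⇒pᵉ∣⊠ k c x y c≤k d = ∣approx⇒pᵉ∣ c (k ∸ c) (x ⊠ y)
    (subst (λ i → pow c ℤ∣.∣ approx x i ℤ.* approx y i) (sym (m∸n+n≡m c≤k)) (ℤ∣.∣-trans (pow-mono c≤k) d))

-- Orders and the two forms of the bound

module Orders (p : ℕ) (pr : Prime p) where
  open Valuation p pr
  open Padic p {{prime⇒nonZero pr}}
  open PadicDivisibility p pr
  open PowersOf[X-1] p pr
  open Carries p pr

  carries : ℕ → ℕ → ℤ → ℕ
  carries zero    n r = 0
  carries (suc β) n r = t β n r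

  J-X-1^-all : ∀ α n → Coefficients.J p pr α (λ r → L (floorQuot n α) + carries α n r) (X-1 ^ᴿ n)
  J-X-1^-all zero    n = Coefficients.J-mono p pr 0
    (λ r → ≤-reflexive (trans (+-identityʳ (L (p * n))) L[pn]≡n+L[n])) (J-X-1^-α≡0 n)
    where
    L[pn]≡n+L[n] : L (p * n) ≡ n + L n
    L[pn]≡n+L[n] = trans (L-step (p * n)) (cong (λ m → m + L m) (trans (/-congˡ (*-comm p n)) (m*n/n≡m n p)))
  J-X-1^-all (suc β) n = Positive.J-X-1^ β n

  τ≤carries : ∀ α n r → τ (residue r α) (residue (+ n - r) α) ≤ carries α n r
  τ≤carries zero    n r = z≤n
  τ≤carries (suc β) n r = τ≤t β n r

  ∑⌊⌋≤L : ∀ α n → ∑⌊ n /p^i⌋,i≥ α ≤ L (floorQuot n α)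
  ∑⌊⌋≤L zero n = begin
    Σ< (λ j → ⌊ n /p^ j ⌋) n                  ≡⟨ Σ<-cong nested n ⟩
    Σ< (λ j → ⌊ p * n /p^ suc j ⌋) n          ≡⟨⟩
    _                                         ≤⟨ Σ<-monoʳ (λ j → ⌊ p * n /p^ suc j ⌋) (m≤n*m n p) ⟩
    L (p * n)                                 ∎
    where
    open ≤-Reasoning
    nested : ∀ j → ⌊ n /p^ j ⌋ ≡ ⌊ p * n /p^ suc j ⌋
    nested j = sym (m*n/m*o≡n/o p n (p ^ j) {{m^n≢0 p j}} {{m^n≢0 p (suc j)}})
  ∑⌊⌋≤L (suc β) n = ≤-reflexive (trans (Σ<-cong nested n) (L-extend (m/n≤m n (p ^ β) {{m^n≢0 p β}})))
    where
    nested : ∀ j → ⌊ n /p^ (suc β + j) ⌋ ≡ ⌊ ⌊ n /p^ β ⌋ /p^ suc j ⌋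
    nested j = sym (trans (⌊⌋-nested n β (suc j)) (cong (⌊ n /p^_⌋) (+-suc β j)))

  p^∣!⇒≤L : ∀ {a m} → p ^ a ∣ℕ m ! → a ≤ L m
  p^∣!⇒≤L {a} {m} d = ≮⇒≥ λ L<a → let u , p∤u , eq = legendre m in
    p∤u (*-cancelˡ-∣ (p ^ L m) {{m^n≢0 p (L m)}}
      (subst₂ _∣ℕ_ (*-comm p (p ^ L m)) eq (∣-trans (p^-mono-∣ L<a) d)))

  -- Serves both as the exponent to be proved and as the index of the component of f and of the sum
  -- in which it is proved.
  ordBound : ℕ → ℕ → ℤ → ℕ
  ordBound α n r = L (floorQuot n α) + carries α n r

  module _ (f : Poly) (α n : ℕ) (r : ℤ) where

    pow∣p^d*S : ∀ d → (∀ j → d < j → coeff f j ≈ 0#) →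
      pow (ordBound α n r) ℤ∣.∣ pow d ℤ.* approx (binomialSum f α n r) (ordBound α n r)
    pow∣p^d*S d high = subst (λ x → pow (ordBound α n r) ℤ∣.∣ pow d ℤ.* x) (sym (approx-binomialSum f n r (ordBound α n r)))
      (J-poly (J-[1-X]^ n (J-X-1^-all α n)) r (approxPoly f (ordBound α n r)) d λ j d<j → coeff≈0⇒∣ f j (ordBound α n r) (high j d<j))
      where open Weights p pr α

    S≈0 : (∀ j → coeff f j ≈ 0#) → binomialSum f α n r ≈ 0#
    S≈0 f≈0 = mk≈ λ i → subst (pow i ℤ∣.∣_) (sym (trans (ℤ.+-identityʳ _) (approx-binomialSum f n r i)))
      (⟪⟫-factor ([1-X]^ n) r (pow i) (approxPoly f i) λ j → coeff≈0⇒∣ f j i (f≈0 j))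
      where open Weights p pr α

    pow∣p^deg*S : ∀ deg → HasDegree f deg →
      pow (ordBound α n r) ℤ∣.∣ approx (p^deg deg) (ordBound α n r) ℤ.* approx (binomialSum f α n r) (ordBound α n r)
    pow∣p^deg*S ⊥₋    _          = subst (pow (ordBound α n r) ℤ∣.∣_)
      (sym (ℤ.*-zeroˡ (approx (binomialSum f α n r) (ordBound α n r)))) (ℤ∣.divides 0ℤ refl)
    pow∣p^deg*S [ d ] (_ , high) = pow∣p^d*S d high

    -- A negative exponent is harmless for any element of ℤₚ. Otherwise the bound is d + c, and
    -- cancelling p^d leaves p^c dividing component d + c of the sum.
    S÷p^ : ∀ d c → + (ordBound α n r) - + d ≡ c → (∀ j → d < j → coeff f j ≈ 0#) → binomialSum f α n r ÷p^ c ∈ℤₚ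
    S÷p^ d -[1+ c ] eq high = pᵉ (suc c) ⊠ binomialSum f α n r ,
      mk≈ λ i → subst (pow i ℤ∣.∣_) (sym (ℤ.+-inverseʳ (approx (pᵉ (suc c) ⊠ binomialSum f α n r) i))) (ℤ∣.divides 0ℤ refl)
    S÷p^ d (+ c)    eq high = ∣approx⇒pᵉ∣ c d (binomialSum f α n r) (ℤ∣.*-cancelˡ-∣ (pow d) {{m^n≢0 p d}}
      (subst₂ (λ x k → x ℤ∣.∣ pow d ℤ.* approx (binomialSum f α n r) k) (trans (cong pow K≡d+c) (pow-+ d c)) K≡d+c (pow∣p^d*S d high)))
      where
      K≡d+c : ordBound α n r ≡ d + c
      K≡d+c = ℤ.+-injective (trans (add-back (+ (ordBound α n r)) (+ d)) (trans (cong (λ x → + d ℤ.+ x) eq) (sym (ℤ.pos-+ d c))))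
        where
        add-back : ∀ k d → k ≡ d ℤ.+ (k - d)
        add-back = ℤ-Solver.solve-∀

  ord-!≤L : ∀ {m v} → IsOrd (fromℤ (+ (m !))) [ v ] → v ℤ.≤ + L m
  ord-!≤L {m} {+ a}      (_ , d , _) = ℤ.+≤+ (p^∣!⇒≤L {a} {m} (ℤ∣.∣⇒∣ᵤ (pᵉ∣⇒∣approx a d)))
  ord-!≤L {m} { -[1+ a ]} _           = ℤ.-≤+

  !≉0 : ∀ m → ¬ fromℤ (+ (m !)) ≈ 0#
  !≉0 m eq = <-irrefl refl (p^∣!⇒≤L {suc (L m)} {m} (ℤ∣.∣⇒∣ᵤ
    (subst (pow (suc (L m)) ℤ∣.∣_) (ℤ.+-identityʳ (+ (m !))) (congruent eq (suc (L m))))))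

  ord-bound : (f : Poly) (α n : ℕ) (r : ℤ) (deg : ℕ ₋) → HasDegree f deg → (ordS ordFact : ℤ ⁺) →
    IsOrd (binomialSum f α n r) ordS → IsOrd (fromℤ (+ (floorQuot n α !))) ordFact →
    (ordFact ⊖ deg ⊕ τ (residue r α) (residue (+ n - r) α)) ≤⁺ ordS
  ord-bound f α n r deg   hd ⊤⁺    ordFact isS isF = _ ≤⊤⁺
  -- The infinite values: a factorial is nonzero, so its order is finite, and degree -∞ makes the
  -- sum 0, against its finite order.
  ord-bound f α n r deg   hd [ a ] ⊤⁺      isS isF = contradiction isF (!≉0 (floorQuot n α))
  ord-bound f α n r ⊥₋    hd [ a ] [ v ]   (S≉0 , _) isF = contradiction (S≈0 f α n r hd) S≉0
  ord-bound f α n r [ d ] (_ , high) [ a ] [ v ]   (_ , _ , max) isF = [ ℤ.≤-trans bound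
      (max _ (S÷p^ f α n r d _ refl high)) ]
    where
    l = L (floorQuot n α)
    rearrange : ∀ l d c → l - d ℤ.+ c ≡ l ℤ.+ c - d
    rearrange = ℤ-Solver.solve-∀
    bound : v - + d ℤ.+ + τ (residue r α) (residue (+ n - r) α) ℤ.≤ + ordBound α n r - + d
    bound = ℤ.≤-trans (ℤ.+-mono-≤ (ℤ.+-monoˡ-≤ (ℤ.- + d) (ord-!≤L {floorQuot n α} isF)) (ℤ.+≤+ (τ≤carries α n r)))
      (ℤ.≤-reflexive (trans (rearrange (+ l) (+ d) (+ carries α n r))
        (cong (_- + d) (sym (ℤ.pos-+ l (carries α n r))))))

  p^deg-congruence : (f : Poly) (α n : ℕ) (r : ℤ) (deg : ℕ ₋) → HasDegree f deg →
    pᵉ (∑⌊ n /p^i⌋,i≥ α + τ (residue r α) (residue (+ n - r) α)) ∣ (p^deg deg ⊠ binomialSum f α n r)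
  p^deg-congruence f α n r deg hd = ∣approx*approx⇒pᵉ∣⊠ (ordBound α n r)
    (∑⌊ n /p^i⌋,i≥ α + τ (residue r α) (residue (+ n - r) α)) (p^deg deg) (binomialSum f α n r)
    (+-mono-≤ (∑⌊⌋≤L α n) (τ≤carries α n r)) (pow∣p^deg*S f α n r deg hd)

theorem1p1 : (p : ℕ) (pr : Prime p) →
  let open Padic p {{prime⇒nonZero pr}} in
  (f : Poly) (α n : ℕ) (r : ℤ) (deg : ℕ ₋) → HasDegree f deg →
  let S = binomialSum f α n r
      t = τ (residue r α) (residue (+ n - r) α)
  in
  ((ordS ordFact : ℤ ⁺) → IsOrd S ordS → IsOrd (fromℤ (+ (floorQuot n α !))) ordFact →
     (ordFact ⊖ deg ⊕ t) ≤⁺ ordS)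
  × pᵉ (∑⌊ n /p^i⌋,i≥ α + t) ∣ (p^deg deg ⊠ S)
theorem1p1 p pr f α n r deg hd =
  Orders.ord-bound p pr f α n r deg hd , Orders.p^deg-congruence p pr f α n r deg hd
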